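{- Let $\mathcal{G}([-1,1])$ be the represented space of Gevrey functions on $[-1,1]$. Bounded division $$\mathrm{div}\colon\subseteq\mathcal{G}([-1,1])\times\mathcal{G}([-1,1])\to\mathcal{G}([-1,1]),\quad (f,g)\mapsto f/g,$$ with $\mathrm{dom}(\mathrm{div})=\{(f,g)\in\mathcal{G}([-1,1])\times\mathcal{G}([-1,1]) : g(x)\ge1\text{ for all }x\in[-1,1]\}$, is not polytime computable with respect to the given representation of $\mathcal{G}([-1,1])$.
   Context: Second-order complexity. $2^*$ is the set of finite binary strings. $\varphi\colon 2^*\to 2^*$ is length-monotone if $|u|\le|v|$ implies $|\varphi(u)|\le|\varphi(v)|$; $\mathcal{M}$ is the set of such functions, $|\varphi|(n)=|\varphi(0^n)|$. Second-order polynomials are built from the constant $1$ and the number variable $X$ by $+$, $\cdot$, and $P\mapsto\Phi(P)$, with $1(f,n)=1$, $X(f,n)=n$, pointwise $+,\cdot$, and $\Phi(P)(f,n)=f(P(f,n))$ for $f\in\mathbb{N}^{\mathbb{N}}$. A partial $F\colon\subseteq\mathcal{M}\to\mathcal{M}$ is polytime computable if an oracle Turing machine, given oracle $\varphi\in\mathrm{dom}(F)$ and input $u\in2^*$, outputs $F(\varphi)(u)$ within time $P(|\varphi|,|u|)$ for some second-order polynomial $P$. A representation of $X$ is a partial surjection $\delta_X\colon\subseteq\mathcal{M}\to X$; $\varphi$ is a name of $\delta_X(\varphi)$. A partial function $f\colon\subseteq X\to Y$ is polytime computable if there is a polytime computable $F\colon\subseteq\mathcal{M}\to\mathcal{M}$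 with $\delta_Y(F(\varphi))=f(\delta_X(\varphi))$ whenever $\delta_X(\varphi)\in\mathrm{dom}(f)$. Finite products: $\langle\varphi_1,\dots,\varphi_n\rangle$ sends $\mathbf{i}\cdot u$ ($\mathbf{i}$ a fixed-length binary code of $i\in\{1,\dots,n\}$) to $\varphi_i(u)\,1\,0^{l(|u|)-|\varphi_i|(|u|)}$ where $l(k)=\max_j|\varphi_j|(k)$, (and other strings to strings of zeros making it length-monotone, the empty string on inputs shorter than $|\mathbf{1}|$); it names the tuple of points named by the $\varphi_i$. $\mathrm{Fun}$: with $\nu_{\mathbb{D}}$ the standard numbering of dyadic rationals (finite binary notation) and $\langle\cdot,\cdot\rangle$ a standard pairing of strings, $\varphi\in\mathcal{M}$ is a $\mathrm{Fun}$-name of a continuous $f\colon[-1,1]\to\mathbb{R}$ iff $|\nu_{\mathbb{D}}(\varphi(\langle u,v\rangle))-f(\nu_{\mathbb{D}}(u))|\le2^{ -|v|}$ for all $u,v\in2^*$ with $\nu_{\mathbb{D}}(u)\in[-1,1]$, and for all $x,y\in[-1,1]$, $n\in\mathbb{N}$: $|x-y|<2^{ -|\varphi|(n)}$ implies $|f(x)-f(y)|<2^{ -n}$. Gevrey functions: an infinitely differentiable $f\colon[-1,1]\to\mathbb{R}$ belongs to Gevrey's hierarchy if there are positive constants $B,\ell,\gamma$ such that $(\ast)$ $|f^{(k)}(x)|\le B\,\ell^k k^{\gamma k}$ for all $x\in[-1,1]$ and $k\in\mathbb{N}$ ($0^0=1$). $\mathcal{G}([-1,1])$ is the space of all functions in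 Gevrey's hierarchy, where a name of $f$ is given by a $\mathrm{Fun}$-name of $f$ together with positive integer constants $B,\ell,\gamma$ satisfying $(\ast)$; the constant $B$ is encoded in binary, $\ell$ is encoded in unary, and $\gamma$ is given by an encoding of $2^{\gamma}$ in unary. -}

module Defs where

open import Level using (0ℓ)
open import Data.Bool using (Bool; true; false; if_then_else_)
open import Data.Fin using (Fin; fromℕ<)
open import Data.Fin.Patterns using (0F; 1F; 2F; 3F)
open import Data.Integer using (+_)
open import Data.List using (List; []; _∷_; _++_; length; map; take; drop; replicate; reverse)
open import Data.List.Properties using (length-++; length-replicate; length-drop)
open import Data.Maybe using (Maybe; just; nothing)
open import Data.Nat using (ℕ; zero; suc; _+_; _*_; _^_; _∸_; _⊔_; _≤_; _<_; z≤n; s≤s; _≤?_; _<?_)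
open import Data.Nat.Logarithm using (⌈log₂_⌉)
import Data.Nat.Properties as ℕₚ
open import Data.Product using (Σ; ∃; ∃-syntax; Σ-syntax; _×_; _,_; proj₁; proj₂)
import Data.Rational
open import Data.Rational as ℚ using (ℚ; 0ℚ; 1ℚ; ½)
import Data.Rational.Properties as ℚₚ
open import Data.Rational.Solver using (module +-*-Solver)
open import Data.Sum using (inj₁; inj₂)
open import Data.Vec as Vec using (Vec; []; _∷_)
open import Data.Vec.Functional as VF using ()
open import Function using (_on_; _∘_; const)
open import Function.Bundles using (Func; _⟨$⟩_)
import Function.Relation.Binary.Setoid.Equality as FunctionEquality
open import Relation.Binary.Bundles using (Setoid)
import Relation.Binary.Construct.On as On
open import Data.Product.Relation.Binary.Pointwise.NonDependent using (×-setoid)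
open import Relation.Binary.PropositionalEquality
  using (_≡_; _≢_; _≗_; refl; sym; trans; cong; cong₂; subst; subst₂)
open import Relation.Nullary using (yes; no; contradiction)

Word : Set
Word = List Bool

zeros : ℕ → Word
zeros n = replicate n false

record 𝓜 : Set where
  field
    fun      : Word → Word
    monotone : ∀ u v → length u ≤ length v → length (fun u) ≤ length (fun v)

open 𝓜 public using (fun)

size : 𝓜 → ℕ → ℕ
size φ n = length (fun φ (zeros n))

_≐_ : 𝓜 → 𝓜 → Set
φ ≐ ψ = fun φ ≗ fun ψ

infixl 6 _⊕_
infixl 7 _⊗_
data SecondOrderPolynomial : Set where
  𝟙   : SecondOrderPolynomial
  X   : SecondOrderPolynomial
  _⊕_ : SecondOrderPolynomial → SecondOrderPolynomial → SecondOrderPolynomial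
  _⊗_ : SecondOrderPolynomial → SecondOrderPolynomial → SecondOrderPolynomial
  Φ   : SecondOrderPolynomial → SecondOrderPolynomial

⟦_⟧ : SecondOrderPolynomial → (ℕ → ℕ) → ℕ → ℕ
⟦ 𝟙 ⟧     f n = 1
⟦ X ⟧     f n = n
⟦ P ⊕ Q ⟧ f n = ⟦ P ⟧ f n + ⟦ Q ⟧ f n
⟦ P ⊗ Q ⟧ f n = ⟦ P ⟧ f n * ⟦ Q ⟧ f n
⟦ Φ P ⟧   f n = f (⟦ P ⟧ f n)

data Symbol (k : ℕ) : Set where
  blank : Symbol k
  bit   : Bool → Symbol k
  extra : Fin k → Symbol k

data Move : Set where
  left stay right : Move

-- A tape is infinite to the right only.  `before` lists the cells to the
-- left of the head, nearest first; `after` starts with the scanned cell.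
-- All cells beyond `after` are blank.
record Tape (k : ℕ) : Set where
  constructor tape
  field
    before after : List (Symbol k)

open Tape public

module _ {k : ℕ} where

  scanned : Tape k → Symbol k
  scanned (tape _ [])      = blank
  scanned (tape _ (s ∷ _)) = s

  write : Symbol k → Tape k → Tape k
  write s (tape l [])      = tape l (s ∷ [])
  write s (tape l (_ ∷ r)) = tape l (s ∷ r)

  -- Moving left from the first cell leaves the head where it is.
  move : Move → Tape k → Tape k
  move stay  t                = t
  move left  (tape [] r)      = tape [] r
  move left  (tape (s ∷ l) r) = tape l (s ∷ r)
  move right (tape l [])      = tape (blank ∷ l) []
  move right (tape l (s ∷ r)) = tape (s ∷ l) r

  act : Symbol k × Move → Tape k → Tape k
  act (s , m) t = move m (write s t)

  bitPrefix : List (Symbol k) → Word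
  bitPrefix (bit b ∷ ss) = b ∷ bitPrefix ss
  bitPrefix _            = []

  contents : Tape k → Word
  contents (tape l r) = bitPrefix (reverse l ++ r)

  emptyTape : Tape k
  emptyTape = tape [] []

  wordTape : Word → Tape k
  wordTape w = tape [] (map bit w)

data Instruction (states k tapes : ℕ) : Set where
  halt  : Instruction states k tapes
  goto  : Fin states → Vec (Symbol k × Move) tapes → Instruction states k tapes
  query : Fin states → Instruction states k tapes

-- Tapes 0, 1, 2, 3 are the input, output, query and answer tapes; the
-- others are work tapes.
record OracleMachine : Set where
  field
    states extras works : ℕ
    start   : Fin states
    program : Fin states → Vec (Symbol extras) (4 + works) →
              Instruction states extras (4 + works)

module Run (M : OracleMachine) (φ : 𝓜) where
  open OracleMachine M

  -- The state is `nothing` once the machine has halted.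
  Configuration : Set
  Configuration = Maybe (Fin states) × Vec (Tape extras) (4 + works)

  execute : Instruction states extras (4 + works) →
            Vec (Tape extras) (4 + works) → Configuration
  execute halt          ts                 = nothing , ts
  execute (goto s acts) ts                 = just s , Vec.zipWith act acts ts
  execute (query s)     (i ∷ o ∷ q ∷ _ ∷ w) =
    just s , i ∷ o ∷ emptyTape ∷ wordTape (fun φ (contents q)) ∷ w

  step : Configuration → Configuration
  step (nothing , ts) = nothing , ts
  step (just s  , ts) = execute (program s (Vec.map scanned ts)) ts

  initial : Word → Configuration
  initial u = just start , wordTape u ∷ Vec.replicate _ emptyTape

  run : ℕ → Word → Configuration
  run zero    u = initial u
  run (suc t) u = step (run t u)

  -- A halted machine stays put, so this says it halts in at most t steps.
  OutputsWithin : ℕ → Word → Word → Set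
  OutputsWithin t u v =
    proj₁ (run t u) ≡ nothing × contents (Vec.lookup (proj₂ (run t u)) 1F) ≡ v

open Run public using (OutputsWithin)

record PartialOperator : Set₁ where
  field
    dom     : 𝓜 → Set
    apply   : ∀ φ → dom φ → 𝓜
    cong-≐  : ∀ {φ ψ} (p : dom φ) (q : dom ψ) → φ ≐ ψ → apply φ p ≐ apply ψ q

PolytimeOperator : PartialOperator → Set
PolytimeOperator F =
  Σ[ M ∈ OracleMachine ] Σ[ P ∈ SecondOrderPolynomial ]
    (∀ φ (p : dom φ) u →
       OutputsWithin M φ (⟦ P ⟧ (size φ) (length u)) u (fun (apply φ p) u))
  where open PartialOperator F

-- φ ⊩ x : φ is a name of x, i.e. the graph of the representation.
record RepresentedSpace : Set₁ where
  field
    Points : Setoid 0ℓ 0ℓ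
    _⊩_    : 𝓜 → Setoid.Carrier Points → Set

  open Setoid Points public renaming (Carrier to Point)

-- x ↦ y : the value at x is y.  Only points x in Dom matter, and being
-- computable includes having a value at each of them.
record PartialFunction (𝐗 𝐘 : RepresentedSpace) : Set₁ where
  private
    module 𝐗 = RepresentedSpace 𝐗
    module 𝐘 = RepresentedSpace 𝐘
  field
    Dom           : 𝐗.Point → Set
    _↦_           : 𝐗.Point → 𝐘.Point → Set
    single-valued : ∀ {x x′ y y′} → x 𝐗.≈ x′ → x ↦ y → x′ ↦ y′ → y 𝐘.≈ y′

PolytimeComputable : (𝐗 𝐘 : RepresentedSpace) → PartialFunction 𝐗 𝐘 → Set₁
PolytimeComputable 𝐗 𝐘 f =
  Σ[ F ∈ PartialOperator ] PolytimeOperator F ×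
    (∀ φ x → φ 𝐗.⊩ x → Dom x →
       Σ[ p ∈ PartialOperator.dom F φ ]
       Σ[ y ∈ 𝐘.Point ] (PartialOperator.apply F φ p 𝐘.⊩ y × x ↦ y))
  where
  module 𝐗 = RepresentedSpace 𝐗
  module 𝐘 = RepresentedSpace 𝐘
  open PartialFunction f

digit : Bool → ℕ
digit b = if b then 1 else 0

-- Binary notation is read with the most significant bit first.
binaryFrom : ℕ → Word → ℕ
binaryFrom a []      = a
binaryFrom a (b ∷ w) = binaryFrom (digit b + 2 * a) w

binary : Word → ℕ
binary = binaryFrom 0

constant : Word → 𝓜
constant w = record { fun = const w ; monotone = λ _ _ _ → ℕₚ.≤-refl }

length-fun : ∀ φ u → length (fun φ u) ≡ size φ (length u)
length-fun φ u = ℕₚ.≤-antisym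
  (𝓜.monotone φ _ _ (ℕₚ.≤-reflexive (sym (length-replicate (length u)))))
  (𝓜.monotone φ _ _ (ℕₚ.≤-reflexive (length-replicate (length u))))

size-mono : ∀ φ {m n} → m ≤ n → size φ m ≤ size φ n
size-mono φ {m} {n} m≤n = 𝓜.monotone φ _ _
  (subst₂ _≤_ (sym (length-replicate m)) (sym (length-replicate n)) m≤n)

maxSize : ∀ {n} → (Fin n → 𝓜) → ℕ → ℕ
maxSize φs k = VF.foldr _⊔_ 0 (λ j → size (φs j) k)

size≤maxSize : ∀ {n} (φs : Fin n → 𝓜) k i → size (φs i) k ≤ maxSize φs k
size≤maxSize φs k Fin.zero    = ℕₚ.m≤m⊔n _ _
size≤maxSize φs k (Fin.suc i) =
  ℕₚ.≤-trans (size≤maxSize (φs ∘ Fin.suc) k i) (ℕₚ.m≤n⊔m (size (φs 0F) k) _)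

maxSize-mono : ∀ {n} (φs : Fin n → 𝓜) {k l} → k ≤ l → maxSize φs k ≤ maxSize φs l
maxSize-mono {zero}  φs k≤l = z≤n
maxSize-mono {suc n} φs k≤l =
  ℕₚ.⊔-mono-≤ (size-mono (φs 0F) k≤l) (maxSize-mono (φs ∘ Fin.suc) k≤l)

-- The i-th component (counting from 0) is addressed by the ⌈log₂ n⌉-bit
-- binary notation of i.  A word whose address part is not below n is sent
-- to as many zeros as length-monotonicity dictates.
module _ {n : ℕ} (φs : Fin n → 𝓜) where

  tupleFun : Word → Word
  tupleFun w with ⌈log₂ n ⌉ ≤? length w | binary (take ⌈log₂ n ⌉ w) <? n
  ... | no  _ | _     = []
  ... | yes _ | no  _ = zeros (suc (maxSize φs (length (drop ⌈log₂ n ⌉ w))))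
  ... | yes _ | yes p =
    fun φᵢ u ++ true ∷ zeros (maxSize φs (length u) ∸ size φᵢ (length u))
    where
    u  = drop ⌈log₂ n ⌉ w
    φᵢ = φs (fromℕ< p)

  length-tupleFun : ∀ w → ⌈log₂ n ⌉ ≤ length w →
                    length (tupleFun w) ≡ suc (maxSize φs (length w ∸ ⌈log₂ n ⌉))
  length-tupleFun w c≤w
    rewrite sym (length-drop ⌈log₂ n ⌉ w)
    with ⌈log₂ n ⌉ ≤? length w | binary (take ⌈log₂ n ⌉ w) <? n
  ... | no c≰w | _     = contradiction c≤w c≰w
  ... | yes _  | no  _ = length-replicate _
  ... | yes _  | yes p = begin
    length (fun φᵢ u ++ true ∷ zeros d)  ≡⟨ length-++ (fun φᵢ u) ⟩
    length (fun φᵢ u) + suc (length (zeros d))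
      ≡⟨ cong₂ (λ a b → a + suc b) (length-fun φᵢ u) (length-replicate d) ⟩
    size φᵢ (length u) + suc d           ≡⟨ ℕₚ.+-suc _ d ⟩
    suc (size φᵢ (length u) + d)
      ≡⟨ cong suc (ℕₚ.m+[n∸m]≡n (size≤maxSize φs (length u) (fromℕ< p))) ⟩
    suc (maxSize φs (length u))          ∎
    where
    open Relation.Binary.PropositionalEquality.≡-Reasoning
    u  = drop ⌈log₂ n ⌉ w
    φᵢ = φs (fromℕ< p)
    d  = maxSize φs (length u) ∸ size φᵢ (length u)

  tupleFun-short : ∀ w → length w < ⌈log₂ n ⌉ → tupleFun w ≡ []
  tupleFun-short w w<c
    with ⌈log₂ n ⌉ ≤? length w | binary (take ⌈log₂ n ⌉ w) <? n
  ... | no  _   | _ = refl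
  ... | yes c≤w | _ = contradiction c≤w (ℕₚ.<⇒≱ w<c)

  tuple : 𝓜
  tuple = record { fun = tupleFun ; monotone = mono }
    where
    mono : ∀ u v → length u ≤ length v → length (tupleFun u) ≤ length (tupleFun v)
    mono u v u≤v with ℕₚ.≤-<-connex ⌈log₂ n ⌉ (length u)
    ... | inj₂ u<c rewrite tupleFun-short u u<c = z≤n
    ... | inj₁ c≤u =
      subst₂ _≤_ (sym (length-tupleFun u c≤u))
                 (sym (length-tupleFun v (ℕₚ.≤-trans c≤u u≤v)))
                 (s≤s (maxSize-mono φs (ℕₚ.∸-monoˡ-≤ ⌈log₂ n ⌉ u≤v)))

infixr 2 _⊠_
_⊠_ : RepresentedSpace → RepresentedSpace → RepresentedSpace
𝐗 ⊠ 𝐘 = record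
  { Points = ×-setoid 𝐗.Points 𝐘.Points
  ; _⊩_    = λ φ (x , y) → ∃[ ψ ] ∃[ χ ]
      (ψ 𝐗.⊩ x × χ 𝐘.⊩ y × φ ≐ tuple (Vec.lookup (ψ ∷ χ ∷ [])))
  }
  where
  module 𝐗 = RepresentedSpace 𝐗
  module 𝐘 = RepresentedSpace 𝐘

Eventually : (ℕ → Set) → Set
Eventually P = ∃[ N ] (∀ n → N ≤ n → P n)

eventually₂ : ∀ {P Q R : ℕ → Set} → (∀ n → P n → Q n → R n) →
              Eventually P → Eventually Q → Eventually R
eventually₂ f (M , p) (N , q) = M ⊔ N , λ n le →
  f n (p n (ℕₚ.≤-trans (ℕₚ.m≤m⊔n M N) le)) (q n (ℕₚ.≤-trans (ℕₚ.m≤n⊔m M N) le))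

dist : ℚ → ℚ → ℚ
dist p q = ℚ.∣ p ℚ.- q ∣

record ℝ : Set where
  no-eta-equality
  field
    seq    : ℕ → ℚ
    cauchy : ∀ ε → 0ℚ ℚ.< ε →
             ∃[ N ] (∀ m n → N ≤ m → N ≤ n → dist (seq m) (seq n) ℚ.≤ ε)

open ℝ public

infix 4 _≈ᴿ_ _≤ᴿ_ _<ᴿ_

record _≈ᴿ_ (x y : ℝ) : Set where
  no-eta-equality
  constructor mk≈
  field close : ∀ ε → 0ℚ ℚ.< ε → Eventually λ n → dist (seq x n) (seq y n) ℚ.≤ ε

record _≤ᴿ_ (x y : ℝ) : Set where
  no-eta-equality
  constructor mk≤
  field below : ∀ ε → 0ℚ ℚ.< ε → Eventually λ n → seq x n ℚ.≤ seq y n ℚ.+ ε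

record _<ᴿ_ (x y : ℝ) : Set where
  no-eta-equality
  constructor mk<
  field
    gap     : ℚ
    gap-pos : 0ℚ ℚ.< gap
    apart   : Eventually λ n → seq x n ℚ.+ gap ℚ.≤ seq y n

open _≈ᴿ_ public
open _≤ᴿ_ public
open _<ᴿ_ public

module ℚLemmas where
  open Data.Rational using (_-_; -_; ∣_∣) renaming (_+_ to _+q_; _*_ to _*q_; _≤_ to _≤q_; _<_ to _<q_)
  open ℚₚ.≤-Reasoning
  open +-*-Solver

  half-pos : ∀ ε → 0ℚ <q ε → 0ℚ <q ½ *q ε
  half-pos ε 0<ε = subst (_<q ½ *q ε) (ℚₚ.*-zeroʳ ½) (ℚₚ.*-monoʳ-<-pos ½ 0<ε)

  halves : ∀ ε → ½ *q ε +q ½ *q ε ≡ ε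
  halves ε = trans (sym (ℚₚ.*-distribʳ-+ ε ½ ½)) (ℚₚ.*-identityˡ ε)

  *-pos : ∀ p q → 0ℚ <q p → 0ℚ <q q → 0ℚ <q p *q q
  *-pos p q 0<p 0<q = subst (_<q p *q q) (ℚₚ.*-zeroʳ p)
    (ℚₚ.*-monoʳ-<-pos p {{ℚ.positive 0<p}} 0<q)

  +-pos : ∀ p q → 0ℚ <q p → 0ℚ <q q → 0ℚ <q p +q q
  +-pos p q = ℚₚ.+-mono-<

  *-mono-nonneg : ∀ {p q r s} → 0ℚ ≤q p → 0ℚ ≤q s → p ≤q q → r ≤q s → p *q r ≤q q *q s
  *-mono-nonneg {p} {q} {r} {s} 0≤p 0≤s p≤q r≤s = begin
    p *q r ≤⟨ ℚₚ.*-monoˡ-≤-nonNeg p {{ℚ.nonNegative 0≤p}} r≤s ⟩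
    p *q s ≤⟨ ℚₚ.*-monoʳ-≤-nonNeg s {{ℚ.nonNegative 0≤s}} p≤q ⟩
    q *q s ∎

  shrink : ∀ K → 0ℚ <q K → ∀ ε → 0ℚ <q ε → ∃[ δ ] (0ℚ <q δ × K *q δ ≡ ε)
  shrink K 0<K ε 0<ε = ℚ.1/ K *q ε , *-pos _ _ 0<1/K 0<ε , eq
    where
    instance
      K-pos : ℚ.Positive K
      K-pos = ℚ.positive 0<K
      K-nz : ℚ.NonZero K
      K-nz = ℚₚ.pos⇒nonZero K
    0<1/K : 0ℚ <q ℚ.1/ K
    0<1/K = ℚₚ.positive⁻¹ _ {{ℚₚ.1/pos⇒pos K}}
    eq : K *q (ℚ.1/ K *q ε) ≡ ε
    eq = trans (sym (ℚₚ.*-assoc K _ ε))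
               (trans (cong (_*q ε) (ℚₚ.*-inverseʳ K)) (ℚₚ.*-identityˡ ε))

  dist-refl : ∀ p → dist p p ≡ 0ℚ
  dist-refl p = cong ∣_∣ (ℚₚ.+-inverseʳ p)

  dist-sym : ∀ p q → dist p q ≡ dist q p
  dist-sym p q = trans (cong ∣_∣ (solve 2 (λ a b → a :- b := :- (b :- a)) refl p q))
                       (ℚₚ.∣-p∣≡∣p∣ (q - p))

  dist-triangle : ∀ p q r → dist p r ≤q dist p q +q dist q r
  dist-triangle p q r = subst (λ z → ∣ z ∣ ≤q dist p q +q dist q r)
    (solve 3 (λ a b c → (a :- b) :+ (b :- c) := a :- c) refl p q r)
    (ℚₚ.∣p+q∣≤∣p∣+∣q∣ (p - q) (q - r))

  dist-halves : ∀ p q r ε → dist p q ≤q ½ *q ε → dist q r ≤q ½ *q ε → dist p r ≤q ε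
  dist-halves p q r ε h k = begin
    dist p r                 ≤⟨ dist-triangle p q r ⟩
    dist p q +q dist q r     ≤⟨ ℚₚ.+-mono-≤ h k ⟩
    ½ *q ε +q ½ *q ε         ≡⟨ halves ε ⟩
    ε ∎

  dist-+ : ∀ p q r s → dist (p +q q) (r +q s) ≤q dist p r +q dist q s
  dist-+ p q r s = subst (λ z → ∣ z ∣ ≤q dist p r +q dist q s)
    (solve 4 (λ a b c d → (a :- c) :+ (b :- d) := (a :+ b) :- (c :+ d)) refl p q r s)
    (ℚₚ.∣p+q∣≤∣p∣+∣q∣ (p - r) (q - s))

  dist-neg : ∀ p q → dist (- p) (- q) ≡ dist p q
  dist-neg p q = trans (cong ∣_∣ (solve 2 (λ a b → (:- a) :- (:- b) := :- (a :- b)) refl p q))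
                       (ℚₚ.∣-p∣≡∣p∣ (p - q))

  ≤-abs : ∀ p → p ≤q ∣ p ∣
  ≤-abs p with ℚₚ.≤-total 0ℚ p
  ... | inj₁ 0≤p = ℚₚ.≤-reflexive (sym (ℚₚ.0≤p⇒∣p∣≡p 0≤p))
  ... | inj₂ p≤0 = ℚₚ.≤-trans p≤0 (ℚₚ.0≤∣p∣ p)

  ≤-+⇒-≤-abs : ∀ p q r → p ≤q q +q r → p - r ≤q ∣ q ∣
  ≤-+⇒-≤-abs p q r h = begin
    p - r            ≤⟨ ℚₚ.+-monoˡ-≤ (- r) h ⟩
    (q +q r) - r     ≡⟨ solve 2 (λ a b → (a :+ b) :- b := a) refl q r ⟩
    q                ≤⟨ ≤-abs q ⟩
    ∣ q ∣            ∎

  abs-≤ : ∀ p q → ∣ p ∣ ≤q ∣ q ∣ +q dist p q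
  abs-≤ p q = subst (λ z → ∣ z ∣ ≤q ∣ q ∣ +q dist p q)
    (solve 2 (λ a b → b :+ (a :- b) := a) refl p q)
    (ℚₚ.∣p+q∣≤∣p∣+∣q∣ q (p - q))

  abs-- : ∀ p q → ∣ p ∣ - ∣ q ∣ ≤q dist p q
  abs-- p q = begin
    ∣ p ∣ - ∣ q ∣                 ≤⟨ ℚₚ.+-monoˡ-≤ (- ∣ q ∣) (abs-≤ p q) ⟩
    (∣ q ∣ +q dist p q) - ∣ q ∣   ≡⟨ solve 2 (λ b d → (b :+ d) :- b := d) refl ∣ q ∣ (dist p q) ⟩
    dist p q                      ∎

  dist-abs : ∀ p q → dist ∣ p ∣ ∣ q ∣ ≤q dist p q
  dist-abs p q with ℚₚ.∣p∣≡p∨∣p∣≡-p (∣ p ∣ - ∣ q ∣)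
  ... | inj₁ eq = subst (_≤q dist p q) (sym eq) (abs-- p q)
  ... | inj₂ eq = begin
    dist ∣ p ∣ ∣ q ∣       ≡⟨ eq ⟩
    - (∣ p ∣ - ∣ q ∣)      ≡⟨ solve 2 (λ a b → :- (a :- b) := b :- a) refl ∣ p ∣ ∣ q ∣ ⟩
    ∣ q ∣ - ∣ p ∣          ≤⟨ abs-- q p ⟩
    dist q p               ≡⟨ dist-sym q p ⟩
    dist p q               ∎

  dist-* : ∀ {p q r s K L δ} → ∣ p ∣ ≤q K → ∣ s ∣ ≤q L →
           dist p r ≤q δ → dist q s ≤q δ → dist (p *q q) (r *q s) ≤q (K +q L) *q δ
  dist-* {p} {q} {r} {s} {K} {L} {δ} p≤K s≤L pr qs = begin
    dist (p *q q) (r *q s)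
      ≡⟨ cong ∣_∣ (solve 4 (λ a b c d → a :* b :- c :* d := a :* (b :- d) :+ d :* (a :- c))
                   refl p q r s) ⟩
    ∣ p *q (q - s) +q s *q (p - r) ∣         ≤⟨ ℚₚ.∣p+q∣≤∣p∣+∣q∣ (p *q (q - s)) _ ⟩
    ∣ p *q (q - s) ∣ +q ∣ s *q (p - r) ∣
      ≡⟨ cong₂ _+q_ (ℚₚ.∣p*q∣≡∣p∣*∣q∣ p (q - s)) (ℚₚ.∣p*q∣≡∣p∣*∣q∣ s (p - r)) ⟩
    ∣ p ∣ *q dist q s +q ∣ s ∣ *q dist p r
      ≤⟨ ℚₚ.+-mono-≤ (*-mono-nonneg (ℚₚ.0≤∣p∣ p) 0≤δ p≤K qs)
                     (*-mono-nonneg (ℚₚ.0≤∣p∣ s) 0≤δ s≤L pr) ⟩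
    K *q δ +q L *q δ                         ≡⟨ sym (ℚₚ.*-distribʳ-+ δ K L) ⟩
    (K +q L) *q δ                            ∎
    where
    0≤δ : 0ℚ ≤q δ
    0≤δ = ℚₚ.≤-trans (ℚₚ.0≤∣p∣ (q - s)) qs

  -- Total inverse, with junk value 0 at 0.
  inv : ℚ → ℚ
  inv p with p ℚₚ.≟ 0ℚ
  ... | yes _   = 0ℚ
  ... | no  p≢0 = ℚ.1/_ p {{ℚ.≢-nonZero p≢0}}

  *-inv : ∀ p → p ≢ 0ℚ → p *q inv p ≡ 1ℚ
  *-inv p p≢0 with p ℚₚ.≟ 0ℚ
  ... | yes p≡0 = contradiction p≡0 p≢0
  ... | no  p≢0 = ℚₚ.*-inverseʳ p {{ℚ.≢-nonZero p≢0}}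

  abs≥⇒≢0 : ∀ {c p} → 0ℚ <q c → c ≤q ∣ p ∣ → p ≢ 0ℚ
  abs≥⇒≢0 0<c c≤∣p∣ refl = ℚₚ.<-irrefl refl (ℚₚ.<-≤-trans 0<c c≤∣p∣)

  dist-inv : ∀ {p q c d ε} → 0ℚ <q c → 0ℚ <q d → c ≤q ∣ p ∣ → d ≤q ∣ q ∣ →
             dist p q ≤q (c *q d) *q ε → dist (inv p) (inv q) ≤q ε
  dist-inv {p} {q} {c} {d} {ε} 0<c 0<d c≤p d≤q pq =
    ℚₚ.*-cancelˡ-≤-pos (c *q d) {{ℚ.positive (*-pos c d 0<c 0<d)}} (begin
      (c *q d) *q dist (inv p) (inv q)
        ≤⟨ *-mono-nonneg (ℚₚ.<⇒≤ (*-pos c d 0<c 0<d)) (ℚₚ.0≤∣p∣ (inv p - inv q))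
             (*-mono-nonneg (ℚₚ.<⇒≤ 0<c) (ℚₚ.0≤∣p∣ q) c≤p d≤q) ℚₚ.≤-refl ⟩
      (∣ p ∣ *q ∣ q ∣) *q dist (inv p) (inv q)
        ≡⟨ cong (_*q dist (inv p) (inv q)) (sym (ℚₚ.∣p*q∣≡∣p∣*∣q∣ p q)) ⟩
      ∣ p *q q ∣ *q dist (inv p) (inv q)
        ≡⟨ sym (ℚₚ.∣p*q∣≡∣p∣*∣q∣ (p *q q) (inv p - inv q)) ⟩
      ∣ (p *q q) *q (inv p - inv q) ∣  ≡⟨ cong ∣_∣ eq ⟩
      dist q p                         ≡⟨ dist-sym q p ⟩
      dist p q                         ≤⟨ pq ⟩
      (c *q d) *q ε                    ∎)
    where
    eq : (p *q q) *q (inv p - inv q) ≡ q - p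
    eq = begin-equality
      (p *q q) *q (inv p - inv q)
        ≡⟨ solve 4 (λ a b i j → (a :* b) :* (i :- j) := (a :* i) :* b :- (b :* j) :* a)
             refl p q (inv p) (inv q) ⟩
      (p *q inv p) *q q - (q *q inv q) *q p
        ≡⟨ cong₂ (λ x y → x *q q - y *q p) (*-inv p (abs≥⇒≢0 0<c c≤p)) (*-inv q (abs≥⇒≢0 0<d d≤q)) ⟩
      1ℚ *q q - 1ℚ *q p
        ≡⟨ cong₂ _-_ (ℚₚ.*-identityˡ q) (ℚₚ.*-identityˡ p) ⟩
      q - p ∎

open ℚLemmas

≈ᴿ-refl : ∀ {x} → x ≈ᴿ x
≈ᴿ-refl {x} .close ε 0<ε = 0 , λ n _ →
  subst (ℚ._≤ ε) (sym (dist-refl (seq x n))) (ℚₚ.<⇒≤ 0<ε)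

≈ᴿ-sym : ∀ {x y} → x ≈ᴿ y → y ≈ᴿ x
≈ᴿ-sym {x} {y} x≈y .close ε 0<ε with close x≈y ε 0<ε
... | N , h = N , λ n N≤n → subst (ℚ._≤ ε) (dist-sym (seq x n) (seq y n)) (h n N≤n)

≈ᴿ-trans : ∀ {x y z} → x ≈ᴿ y → y ≈ᴿ z → x ≈ᴿ z
≈ᴿ-trans {x} {y} {z} x≈y y≈z .close ε 0<ε =
  eventually₂ (λ n → dist-halves (seq x n) (seq y n) (seq z n) ε)
    (close x≈y _ (half-pos ε 0<ε)) (close y≈z _ (half-pos ε 0<ε))

ℝ-setoid : Setoid 0ℓ 0ℓ
ℝ-setoid = record
  { Carrier       = ℝ
  ; _≈_           = _≈ᴿ_
  ; isEquivalence = record { refl = ≈ᴿ-refl ; sym = ≈ᴿ-sym ; trans = ≈ᴿ-trans }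
  }

fromℚ : ℚ → ℝ
fromℚ q .seq = const q
fromℚ q .cauchy ε 0<ε = 0 , λ _ _ _ _ →
  subst (ℚ._≤ ε) (sym (dist-refl q)) (ℚₚ.<⇒≤ 0<ε)

fromℕ : ℕ → ℝ
fromℕ n = fromℚ (+ n ℚ./ 1)

infixl 6 _+ᴿ_ _-ᴿ_
infixl 7 _*ᴿ_ _÷ᴿ_
infix  8 -ᴿ_

-ᴿ_ : ℝ → ℝ
(-ᴿ x) .seq n = ℚ.- seq x n
(-ᴿ x) .cauchy ε 0<ε = let N , h = cauchy x ε 0<ε in N , λ m n N≤m N≤n →
  subst (ℚ._≤ ε) (sym (dist-neg (seq x m) (seq x n))) (h m n N≤m N≤n)

_+ᴿ_ : ℝ → ℝ → ℝ
(x +ᴿ y) .seq n = seq x n ℚ.+ seq y n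
(x +ᴿ y) .cauchy ε 0<ε =
  let M , h = cauchy x (½ ℚ.* ε) (half-pos ε 0<ε)
      N , k = cauchy y (½ ℚ.* ε) (half-pos ε 0<ε)
  in M ⊔ N , λ m n le le′ →
    ℚₚ.≤-trans (dist-+ (seq x m) (seq y m) (seq x n) (seq y n))
      (subst (dist (seq x m) (seq x n) ℚ.+ dist (seq y m) (seq y n) ℚ.≤_) (halves ε)
        (ℚₚ.+-mono-≤
          (h m n (ℕₚ.m⊔n≤o⇒m≤o M N le) (ℕₚ.m⊔n≤o⇒m≤o M N le′))
          (k m n (ℕₚ.m⊔n≤o⇒n≤o M N le) (ℕₚ.m⊔n≤o⇒n≤o M N le′))))

_-ᴿ_ : ℝ → ℝ → ℝ
x -ᴿ y = x +ᴿ (-ᴿ y)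

∣_∣ᴿ : ℝ → ℝ
∣ x ∣ᴿ .seq n = ℚ.∣ seq x n ∣
∣ x ∣ᴿ .cauchy ε 0<ε = let N , h = cauchy x ε 0<ε in N , λ m n N≤m N≤n →
  ℚₚ.≤-trans (dist-abs (seq x m) (seq x n)) (h m n N≤m N≤n)

bounded : ∀ x → ∃[ K ] (0ℚ ℚ.< K × Eventually λ n → ℚ.∣ seq x n ∣ ℚ.≤ K)
bounded x =
  let N , h = cauchy x 1ℚ (ℚₚ.positive⁻¹ 1ℚ) in
  ℚ.∣ seq x N ∣ ℚ.+ 1ℚ ,
  ℚₚ.+-mono-≤-< (ℚₚ.0≤∣p∣ (seq x N)) (ℚₚ.positive⁻¹ 1ℚ) ,
  N , λ n N≤n → ℚₚ.≤-trans (abs-≤ (seq x n) (seq x N))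
                  (ℚₚ.+-monoʳ-≤ ℚ.∣ seq x N ∣ (h n N N≤n ℕₚ.≤-refl))

_*ᴿ_ : ℝ → ℝ → ℝ
(x *ᴿ y) .seq n = seq x n ℚ.* seq y n
(x *ᴿ y) .cauchy ε 0<ε =
  let K , 0<K , A , a = bounded x
      L , 0<L , B , b = bounded y
      δ , 0<δ , eq    = shrink (K ℚ.+ L) (+-pos K L 0<K 0<L) ε 0<ε
      C , c           = cauchy x δ 0<δ
      D , d           = cauchy y δ 0<δ
  in (A ⊔ B) ⊔ (C ⊔ D) , λ m n le le′ →
    let AB≤m = ℕₚ.m⊔n≤o⇒m≤o (A ⊔ B) (C ⊔ D) le
        AB≤n = ℕₚ.m⊔n≤o⇒m≤o (A ⊔ B) (C ⊔ D) le′
        CD≤m = ℕₚ.m⊔n≤o⇒n≤o (A ⊔ B) (C ⊔ D) le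
        CD≤n = ℕₚ.m⊔n≤o⇒n≤o (A ⊔ B) (C ⊔ D) le′
    in subst (dist (seq x m ℚ.* seq y m) (seq x n ℚ.* seq y n) ℚ.≤_) eq
         (dist-* {seq x m} {seq y m} {seq x n} {seq y n} {K} {L} {δ}
           (a m (ℕₚ.m⊔n≤o⇒m≤o A B AB≤m))
           (b n (ℕₚ.m⊔n≤o⇒n≤o A B AB≤n))
           (c m n (ℕₚ.m⊔n≤o⇒m≤o C D CD≤m) (ℕₚ.m⊔n≤o⇒m≤o C D CD≤n))
           (d m n (ℕₚ.m⊔n≤o⇒n≤o C D CD≤m) (ℕₚ.m⊔n≤o⇒n≤o C D CD≤n)))

*ᴿ-cong : ∀ {x x′ y y′} → x ≈ᴿ x′ → y ≈ᴿ y′ → x *ᴿ y ≈ᴿ x′ *ᴿ y′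
*ᴿ-cong {x} {x′} {y} {y′} x≈x′ y≈y′ .close ε 0<ε =
  let K , 0<K , a  = bounded x
      L , 0<L , b  = bounded y′
      δ , 0<δ , eq = shrink (K ℚ.+ L) (+-pos K L 0<K 0<L) ε 0<ε
  in eventually₂
    (λ n (p , q) (r , s) →
      subst (dist (seq x n ℚ.* seq y n) (seq x′ n ℚ.* seq y′ n) ℚ.≤_) eq
        (dist-* {seq x n} {seq y n} {seq x′ n} {seq y′ n} {K} {L} {δ} p q r s))
    (eventually₂ (λ _ → _,_) a b)
    (eventually₂ (λ _ → _,_) (close x≈x′ δ 0<δ) (close y≈y′ δ 0<δ))

Apart₀ : ℝ → Set
Apart₀ x = fromℚ 0ℚ <ᴿ ∣ x ∣ᴿ

apart₀-bound : ∀ x (p : Apart₀ x) → Eventually λ n → gap p ℚ.≤ ℚ.∣ seq x n ∣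
apart₀-bound x p = let N , h = apart p in N , λ n N≤n →
  subst (ℚ._≤ ℚ.∣ seq x n ∣) (ℚₚ.+-identityˡ (gap p)) (h n N≤n)

recip : (x : ℝ) → Apart₀ x → ℝ
recip x p .seq n = inv (seq x n)
recip x p .cauchy ε 0<ε =
  let c     = gap p
      0<c   = gap-pos p
      M , a = apart₀-bound x p
      N , b = cauchy x (c ℚ.* c ℚ.* ε) (*-pos (c ℚ.* c) ε (*-pos c c 0<c 0<c) 0<ε)
  in M ⊔ N , λ m n le le′ →
    dist-inv {seq x m} {seq x n} {c} {c} {ε} 0<c 0<c
      (a m (ℕₚ.m⊔n≤o⇒m≤o M N le)) (a n (ℕₚ.m⊔n≤o⇒m≤o M N le′))
      (b m n (ℕₚ.m⊔n≤o⇒n≤o M N le) (ℕₚ.m⊔n≤o⇒n≤o M N le′))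

recip-cong : ∀ {x y} (p : Apart₀ x) (q : Apart₀ y) → x ≈ᴿ y → recip x p ≈ᴿ recip y q
recip-cong {x} {y} p q x≈y .close ε 0<ε =
  let c   = gap p
      d   = gap q
      0<c = gap-pos p
      0<d = gap-pos q
  in eventually₂ (λ n (a , b) → dist-inv {seq x n} {seq y n} {c} {d} {ε} 0<c 0<d a b)
       (eventually₂ (λ _ → _,_) (apart₀-bound x p) (apart₀-bound y q))
       (close x≈y (c ℚ.* d ℚ.* ε) (*-pos (c ℚ.* d) ε (*-pos c d 0<c 0<d) 0<ε))

_÷ᴿ_ : ℝ → (y : ℝ) → {Apart₀ y} → ℝ
(x ÷ᴿ y) {p} = x *ᴿ recip y p

÷ᴿ-cong : ∀ {x x′ y y′} (p : Apart₀ y) (q : Apart₀ y′) → x ≈ᴿ x′ → y ≈ᴿ y′ →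
          (x ÷ᴿ y) {p} ≈ᴿ (x′ ÷ᴿ y′) {q}
÷ᴿ-cong {x} {x′} {y} {y′} p q x≈x′ y≈y′ =
  *ᴿ-cong {x} {x′} {recip y p} {recip y′ q} x≈x′ (recip-cong p q y≈y′)

1≤⇒apart₀ : ∀ {x} → fromℕ 1 ≤ᴿ x → Apart₀ x
1≤⇒apart₀ {x} 1≤x =
  let N , h = below 1≤x ½ (ℚₚ.positive⁻¹ ½)
  in mk< ½ (ℚₚ.positive⁻¹ ½) (N , λ n N≤n → ≤-+⇒-≤-abs 1ℚ (seq x n) ½ (h n N≤n))

_∈[-1,1] : ℝ → Set
x ∈[-1,1] = (-ᴿ fromℕ 1 ≤ᴿ x) × (x ≤ᴿ fromℕ 1)

𝕀 : Setoid 0ℓ 0ℓ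
𝕀 = record
  { Carrier       = Σ ℝ _∈[-1,1]
  ; _≈_           = _≈ᴿ_ on proj₁
  ; isEquivalence = On.isEquivalence proj₁ (Setoid.isEquivalence ℝ-setoid)
  }

Point𝕀 : Set
Point𝕀 = Setoid.Carrier 𝕀

RealFunction : Set
RealFunction = Func 𝕀 ℝ-setoid

-- At ±1 the derivative is one-sided, as y ranges over [-1,1] only.
HasDerivative : RealFunction → RealFunction → Set
HasDerivative f f′ = ∀ (x : Point𝕀) ε → 0ℚ ℚ.< ε → ∃[ δ ] (0ℚ ℚ.< δ × (∀ (y : Point𝕀) →
  let h = proj₁ y -ᴿ proj₁ x in
  ∣ h ∣ᴿ <ᴿ fromℚ δ →
  ∣ (f ⟨$⟩ y) -ᴿ (f ⟨$⟩ x) -ᴿ (f′ ⟨$⟩ x) *ᴿ h ∣ᴿ ≤ᴿ fromℚ ε *ᴿ ∣ h ∣ᴿ))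

record InfinitelyDifferentiable (f : RealFunction) : Set where
  field
    deriv      : ℕ → RealFunction
    deriv-zero : ∀ x → deriv 0 ⟨$⟩ x ≈ᴿ f ⟨$⟩ x
    deriv-suc  : ∀ k → HasDerivative (deriv k) (deriv (suc k))

open InfinitelyDifferentiable public

GevreyBound : ∀ {f} → InfinitelyDifferentiable f → (B ℓ γ : ℕ) → Set
GevreyBound D B ℓ γ =
  ∀ k x → ∣ deriv D k ⟨$⟩ x ∣ᴿ ≤ᴿ fromℕ (B * ℓ ^ k * k ^ (γ * k))

-- The bound is monotone in B, ℓ and γ, so requiring integer constants
-- excludes no function.
record GevreyFunction : Set where
  field
    function : RealFunction
    smooth   : InfinitelyDifferentiable function
    gevrey   : ∃[ B ] ∃[ ℓ ] ∃[ γ ]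
               (0 < B × 0 < ℓ × 0 < γ × GevreyBound smooth B ℓ γ)

open GevreyFunction public

pair : Word → Word → Word
pair []      v = true ∷ v
pair (b ∷ u) v = false ∷ b ∷ pair u v

fraction : Word → ℚ
fraction []      = 0ℚ
fraction (b ∷ w) = ½ ℚ.* ((+ digit b ℚ./ 1) ℚ.+ fraction w)

magnitude : ℕ → Word → ℚ
magnitude a (false ∷ b ∷ w) = magnitude (digit b + 2 * a) w
magnitude a (true ∷ w)      = (+ a ℚ./ 1) ℚ.+ fraction w
magnitude a _               = + a ℚ./ 1

-- The word s 0a₁ 0a₂ … 0aₘ 1 b₁ … bₙ denotes ± a₁…aₘ.b₁…bₙ, negative iff
-- s = 1.  If the separator 1 is missing there are no fractional digits.
dyadic : Word → ℚ
dyadic []      = 0ℚ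
dyadic (s ∷ w) = if s then ℚ.- magnitude 0 w else magnitude 0 w

2^-_ : ℕ → ℚ
2^- zero  = 1ℚ
2^- suc n = ½ ℚ.* (2^- n)

IsFunName : 𝓜 → RealFunction → Set
IsFunName φ f =
  (∀ u v (p : fromℚ (dyadic u) ∈[-1,1]) →
     ∣ fromℚ (dyadic (fun φ (pair u v))) -ᴿ (f ⟨$⟩ (fromℚ (dyadic u) , p)) ∣ᴿ
       ≤ᴿ fromℚ (2^- length v)) ×
  (∀ (x y : Point𝕀) n →
     ∣ proj₁ x -ᴿ proj₁ y ∣ᴿ <ᴿ fromℚ (2^- size φ n) →
     ∣ (f ⟨$⟩ x) -ᴿ (f ⟨$⟩ y) ∣ᴿ <ᴿ fromℚ (2^- n))

-- The constants are supplied by constant functions.  A positive integer in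
-- binary starts with the digit 1; the integer n in unary is 0ⁿ.
record IsGevreyName (φ : 𝓜) (f : GevreyFunction) : Set where
  field
    funName    : 𝓜
    isFunName  : IsFunName funName (function f)
    B ℓ γ      : ℕ
    0<B        : 0 < B
    0<ℓ        : 0 < ℓ
    0<γ        : 0 < γ
    bound      : GevreyBound (smooth f) B ℓ γ
    digits     : Word
    B-binary   : binary (true ∷ digits) ≡ B
    isTuple    : φ ≐ tuple (Vec.lookup
      (funName ∷ constant (true ∷ digits) ∷ constant (zeros ℓ) ∷ constant (zeros (2 ^ γ)) ∷ []))

𝓖 : RepresentedSpace
𝓖 = record
  { Points = On.setoid (FunctionEquality.setoid 𝕀 ℝ-setoid) function
  ; _⊩_    = IsGevreyName
  }

IsAtLeast1 : GevreyFunction → Set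
IsAtLeast1 g = ∀ x → fromℕ 1 ≤ᴿ function g ⟨$⟩ x

IsQuotient : (f g h : GevreyFunction) → IsAtLeast1 g → Set
IsQuotient f g h g≥1 = ∀ x →
  function h ⟨$⟩ x ≈ᴿ ((function f ⟨$⟩ x) ÷ᴿ (function g ⟨$⟩ x)) {1≤⇒apart₀ (g≥1 x)}

-- If g ≥ 1, then f/g is again a Gevrey function, so div does have a value
-- everywhere on Dom.
div : PartialFunction (𝓖 ⊠ 𝓖) 𝓖
div = record
  { Dom           = λ (f , g) → IsAtLeast1 g
  ; _↦_           = λ (f , g) h → ∃[ g≥1 ] IsQuotient f g h g≥1
  ; single-valued = λ (f≈f′ , g≈g′) (p , h≈) (q , h′≈) x →
      ≈ᴿ-trans (h≈ x)
        (≈ᴿ-trans (÷ᴿ-cong (1≤⇒apart₀ (p x)) (1≤⇒apart₀ (q x)) (f≈f′ x) (g≈g′ x))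
          (≈ᴿ-sym (h′≈ x)))
  }

{-# OPTIONS --safe #-}
module Submission where

-- Divide 1 by g x = 1 + N (1 + x) with N = 2ᴸ.  Since B is written in binary, the
-- pair (1 , g) has names of size n + O(L), on which a polytime machine runs in
-- time 2ᴰ with D = O(log L) for inputs of fixed length.  Reading the constants of
-- the result then gives B ≤ 2 ^ 2ᴰ, ℓ ≤ 2ᴰ and γ ≤ D.  On the other hand the k-th
-- derivative of 1/g at -1 is ± k! Nᵏ, so that at k = 2ᴰ the bound
-- Nᵏ ≤ B ℓᵏ k ^ (γ k) yields L ≤ 1 + D + D², which fails for large L.

open import Defs
open import Data.Bool using (Bool; true; false)
open import Data.Fin using (Fin)
open import Data.Fin.Patterns using (1F; 2F; 3F)
import Data.Integer as ℤ
import Data.Integer.Properties as ℤₚ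
open import Data.List using (List; []; _∷_; _++_; length; reverse)
open import Data.List.Properties using (length-++; length-replicate; length-reverse)
open import Data.Maybe using (just; nothing)
open import Data.Nat as ℕ using (ℕ; zero; suc; _^_; z≤n; s≤s)
open import Data.Nat.Logarithm using (⌈log₂_⌉)
import Data.Nat.Properties as ℕₚ
open import Data.Nat.Solver using () renaming (module +-*-Solver to ℕSolver)
open import Data.Product using (∃-syntax; Σ-syntax; _×_; _,_; proj₁; proj₂)
open import Data.Rational as ℚ using (ℚ; 0ℚ; 1ℚ; ½)
import Data.Rational.Properties as ℚₚ
open import Data.Rational.Solver using () renaming (module +-*-Solver to ℚSolver)
open import Data.Rational.Unnormalised as ℚᵘ using (mkℚᵘ; *≡*)
import Data.Rational.Unnormalised.Properties as ℚᵘₚ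
open import Data.Sum using (inj₁; inj₂)
open import Data.Vec as Vec using (Vec; []; _∷_)
open import Function.Bundles using (_⟨$⟩_)
open import Relation.Binary.PropositionalEquality
  using (_≡_; _≢_; refl; sym; trans; cong; cong₂; subst; subst₂; module ≡-Reasoning)
open import Relation.Nullary using (¬_; Dec; yes; no; does)
open ℚLemmas

-- The obstruction is one of length alone. A machine cannot write more cells than it makes steps,
-- and a tuple pads every component to the longest one, so one short output word limits all three
-- constants of the quotient.
--
-- The encodings of the constants are unequal. The divisor carries its slope in `B`, at the price of
-- one binary digit per doubling. In the quotient the slope becomes the rate of a geometric growth
-- in k, which in the long run only `ℓ` and `γ` can pay for, and these are costly. Since `B` may
-- still reach 2 ^ 2ᴰ, the order k has to be as large as 2ᴰ before the k-th root of `B` drops to 2;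
-- at that order k ^ γ is at most 2 ^ (D * D), which is where the square in the final bound comes
-- from.
--
-- The derivatives of the quotient are not ours to choose: the output names some point with its own
-- family `deriv`, known only through an ε-δ condition. Their values are therefore forced out of the
-- equation g u = 1 by differentiating linear relations. This is done at rational points, where g is
-- a rational number, and evaluated at -1, where g = 1 and the recurrence needs no division.

module _ where

  open import Data.Nat using (_+_; _*_; _≤_; _<_)

  -- Output length of an oracle machine

  module _ {k : ℕ} where

    bitPrefix-length : (ss : List (Symbol k)) → length (bitPrefix ss) ≤ length ss
    bitPrefix-length []             = z≤n
    bitPrefix-length (blank ∷ ss)   = z≤n
    bitPrefix-length (bit b ∷ ss)   = s≤s (bitPrefix-length ss)
    bitPrefix-length (extra _ ∷ ss) = z≤n

    cells : Tape k → ℕ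
    cells (tape l r) = length l + length r

    contents-length : ∀ t → length (contents t) ≤ cells t
    contents-length (tape l r) = begin
      length (bitPrefix (reverse l ++ r)) ≤⟨ bitPrefix-length (reverse l ++ r) ⟩
      length (reverse l ++ r)             ≡⟨ length-++ (reverse l) ⟩
      length (reverse l) + length r       ≡⟨ cong (_+ length r) (length-reverse l) ⟩
      length l + length r                 ∎
      where open ℕₚ.≤-Reasoning

    cells-act : ∀ a t → cells (act a t) ≤ suc (cells t)
    cells-act (s , stay)  (tape l [])            = ℕₚ.≤-reflexive (ℕₚ.+-suc (length l) 0)
    cells-act (s , stay)  (tape l (_ ∷ r))       = ℕₚ.n≤1+n _
    cells-act (s , left)  (tape [] [])           = ℕₚ.≤-refl
    cells-act (s , left)  (tape [] (_ ∷ r))      = ℕₚ.n≤1+n _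
    cells-act (s , left)  (tape (_ ∷ l) [])      = ℕₚ.≤-reflexive
      (trans (ℕₚ.+-suc (length l) 1) (cong suc (ℕₚ.+-suc (length l) 0)))
    cells-act (s , left)  (tape (_ ∷ l) (_ ∷ r)) =
      ℕₚ.≤-trans (ℕₚ.≤-reflexive (ℕₚ.+-suc (length l) (suc (length r)))) (ℕₚ.n≤1+n _)
    cells-act (s , right) (tape l [])            = ℕₚ.≤-refl
    cells-act (s , right) (tape l (_ ∷ r))       =
      ℕₚ.≤-trans (ℕₚ.≤-reflexive (sym (ℕₚ.+-suc (length l) (length r)))) (ℕₚ.n≤1+n _)

  module _ (M : OracleMachine) (φ : 𝓜) where
    open OracleMachine M
    open Run M φ hiding (OutputsWithin)

    outputCells : Configuration → ℕ
    outputCells c = cells (Vec.lookup (proj₂ c) 1F)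

    -- An oracle answer may be arbitrarily long, but a query puts it on the answer tape in one step
    -- and leaves the output tape alone.
    outputCells-step : ∀ c → outputCells (step c) ≤ suc (outputCells c)
    outputCells-step (nothing , ts) = ℕₚ.n≤1+n _
    outputCells-step (just s , ts@(_ ∷ o ∷ _ ∷ _ ∷ _)) with program s (Vec.map scanned ts)
    ... | halt                 = ℕₚ.n≤1+n _
    ... | goto _ (_ ∷ a ∷ _)   = cells-act a o
    ... | query _              = ℕₚ.n≤1+n _

    outputCells-run : ∀ t u → outputCells (run t u) ≤ t
    outputCells-run zero    u = z≤n
    outputCells-run (suc t) u =
      ℕₚ.≤-trans (outputCells-step (run t u)) (s≤s (outputCells-run t u))

    output-length : ∀ {t u v} → OutputsWithin M φ t u v → length v ≤ t
    output-length {t} {u} (_ , refl) =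
      ℕₚ.≤-trans (contents-length (Vec.lookup (proj₂ (run t u)) 1F)) (outputCells-run t u)

  -- Second-order polynomials at slowly growing oracles

  degree : SecondOrderPolynomial → ℕ
  degree 𝟙       = 0
  degree X       = 1
  degree (P ⊕ Q) = suc (degree P + degree Q)
  degree (P ⊗ Q) = degree P + degree Q
  degree (Φ P)   = suc (suc (degree P))

  module _ {f : ℕ → ℕ} {n M : ℕ} (2≤M : 2 ≤ M) (n≤M : n ≤ M) (f≤ : ∀ m → f m ≤ m + M) where

    open ℕₚ.≤-Reasoning

    private instance
      M-nonZero : ℕ.NonZero M
      M-nonZero = ℕ.>-nonZero (ℕₚ.<⇒≤ 2≤M)

    doubled-power : ∀ a → M ^ a + M ^ a ≤ M ^ suc a
    doubled-power a = begin
      M ^ a + M ^ a   ≡⟨ cong (M ^ a +_) (sym (ℕₚ.+-identityʳ (M ^ a))) ⟩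
      2 * M ^ a       ≤⟨ ℕₚ.*-monoˡ-≤ (M ^ a) 2≤M ⟩
      M ^ suc a       ∎

    -- Nesting of `Φ` is harmless here: the oracle adds at most M to its argument, so `Φ` raises the
    -- exponent by a constant instead of multiplying it. Each sum of two powers costs a factor 2,
    -- absorbed by one more factor M.
    ⟦⟧-bound : ∀ P → ⟦ P ⟧ f n ≤ M ^ degree P
    ⟦⟧-bound 𝟙       = ℕₚ.≤-refl
    ⟦⟧-bound X       = ℕₚ.≤-trans n≤M (ℕₚ.≤-reflexive (sym (ℕₚ.^-identityʳ M)))
    ⟦⟧-bound (P ⊕ Q) = begin
      ⟦ P ⟧ f n + ⟦ Q ⟧ f n      ≤⟨ ℕₚ.+-mono-≤ (⟦⟧-bound P) (⟦⟧-bound Q) ⟩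
      M ^ a + M ^ b              ≤⟨ ℕₚ.+-mono-≤ (ℕₚ.^-monoʳ-≤ M (ℕₚ.m≤m+n a b))
                                                (ℕₚ.^-monoʳ-≤ M (ℕₚ.m≤n+m b a)) ⟩
      M ^ (a + b) + M ^ (a + b)  ≤⟨ doubled-power (a + b) ⟩
      M ^ suc (a + b)            ∎
      where
      a = degree P
      b = degree Q
    ⟦⟧-bound (P ⊗ Q) = begin
      ⟦ P ⟧ f n * ⟦ Q ⟧ f n      ≤⟨ ℕₚ.*-mono-≤ (⟦⟧-bound P) (⟦⟧-bound Q) ⟩
      M ^ degree P * M ^ degree Q ≡⟨ sym (ℕₚ.^-distribˡ-+-* M (degree P) (degree Q)) ⟩
      M ^ (degree P + degree Q)  ∎
    ⟦⟧-bound (Φ P)   = begin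
      f (⟦ P ⟧ f n)              ≤⟨ f≤ (⟦ P ⟧ f n) ⟩
      ⟦ P ⟧ f n + M
        ≤⟨ ℕₚ.+-mono-≤ (⟦⟧-bound P) (ℕₚ.≤-reflexive (sym (ℕₚ.^-identityʳ M))) ⟩
      M ^ a + M ^ 1              ≤⟨ ℕₚ.+-mono-≤ (ℕₚ.^-monoʳ-≤ M (ℕₚ.n≤1+n a))
                                                (ℕₚ.^-monoʳ-≤ M {1} {suc a} (s≤s z≤n)) ⟩
      M ^ suc a + M ^ suc a      ≤⟨ doubled-power (suc a) ⟩
      M ^ suc (suc a)            ∎
      where a = degree P

  -- Estimates with powers of two

  n<2^n : ∀ n → n < 2 ^ n
  n<2^n zero    = s≤s z≤n
  n<2^n (suc n) = ℕₚ.+-mono-≤ (ℕₚ.m^n>0 2 n)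
    (ℕₚ.≤-trans (n<2^n n) (ℕₚ.≤-reflexive (sym (ℕₚ.+-identityʳ _))))

  -- The left side is 1 + 12d + 4d², which is below 16 (1 + d)² ≤ 16 · 2ᵈ · 2ᵈ = 2ᵐ. The polynomial
  -- added in the second step is the slack in the first of these inequalities.
  2^-dominates : ∀ d m → m ≡ 4 + 2 * d → 1 + d * (m + m + 4) < 2 ^ m
  2^-dominates d m m≡ = begin-strict
    1 + d * (m + m + 4)             ≡⟨ cong (λ m → 1 + d * (m + m + 4)) m≡ ⟩
    1 + d * (4 + 2 * d + (4 + 2 * d) + 4)
      <⟨ ℕₚ.m≤m+n _ (14 + 20 * d + 12 * (d * d)) ⟩
    2 + d * (4 + 2 * d + (4 + 2 * d) + 4) + (14 + 20 * d + 12 * (d * d))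
      ≡⟨ solve 1 (λ d → con 2 :+ d :* ((con 4 :+ con 2 :* d) :+ (con 4 :+ con 2 :* d) :+ con 4)
                           :+ (con 14 :+ con 20 :* d :+ con 12 :* (d :* d))
                     := con 16 :* ((con 1 :+ d) :* (con 1 :+ d))) refl d ⟩
    16 * ((1 + d) * (1 + d))        ≤⟨ ℕₚ.*-monoʳ-≤ 16 (ℕₚ.*-mono-≤ (n<2^n d) (n<2^n d)) ⟩
    16 * (2 ^ d * 2 ^ d)            ≡⟨ cong (16 *_) (sym (ℕₚ.^-distribˡ-+-* 2 d d)) ⟩
    16 * 2 ^ (d + d)                ≡⟨ cong (λ x → 16 * 2 ^ (d + x)) (sym (ℕₚ.+-identityʳ d)) ⟩
    2 ^ 4 * 2 ^ (2 * d)             ≡⟨ sym (ℕₚ.^-distribˡ-+-* 2 4 (2 * d)) ⟩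
    2 ^ (4 + 2 * d)                 ≡⟨ cong (2 ^_) (sym m≡) ⟩
    2 ^ m                           ∎
    where
    open ℕₚ.≤-Reasoning
    open ℕSolver

  -- Squaring `2^-dominates`; this is why the exponent of L is m + m.
  square-dominates : ∀ d m → m ≡ 4 + 2 * d →
    let D = d * (m + m + 4) in 1 + D + D * D < 2 ^ (m + m)
  square-dominates d m m≡ = begin-strict
    1 + D + D * D          ≤⟨ ℕₚ.m≤m+n _ D ⟩
    1 + D + D * D + D
      ≡⟨ solve 1 (λ x → con 1 :+ x :+ x :* x :+ x := (con 1 :+ x) :* (con 1 :+ x)) refl D ⟩
    (1 + D) * (1 + D)      <⟨ ℕₚ.*-mono-< (2^-dominates d m m≡) (2^-dominates d m m≡) ⟩
    2 ^ m * 2 ^ m          ≡⟨ sym (ℕₚ.^-distribˡ-+-* 2 m m) ⟩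
    2 ^ (m + m)            ∎
    where
    open ℕₚ.≤-Reasoning
    open ℕSolver
    D = d * (m + m + 4)

  2^-cancel-≤ : ∀ m n → 2 ^ m ≤ 2 ^ n → m ≤ n
  2^-cancel-≤ m n 2^m≤2^n = ℕₚ.≮⇒≥ λ n<m →
    ℕₚ.<⇒≱ (ℕₚ.^-monoʳ-< 2 (s≤s (s≤s z≤n)) n<m) 2^m≤2^n

  -- The order k = 2ᴰ turns the bound on the k-th derivative into a bound on L.
  slope-bound : ∀ L D {B ℓ γ} → let k = 2 ^ D in
    B ≤ 2 ^ k → ℓ ≤ 2 ^ D → 2 ^ γ ≤ 2 ^ D →
    (2 ^ L) ^ k ≤ B * ℓ ^ k * k ^ (γ * k) → L ≤ 1 + D + D * D
  slope-bound L D {B} {ℓ} {γ} B≤ ℓ≤ 2^γ≤ h =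
    ℕₚ.*-cancelʳ-≤ L (1 + D + D * D) k {{ℕₚ.m^n≢0 2 D}}
      (2^-cancel-≤ (L * k) _ (begin
        2 ^ (L * k)                                ≡⟨ sym (ℕₚ.^-*-assoc 2 L k) ⟩
        (2 ^ L) ^ k                                ≤⟨ h ⟩
        B * ℓ ^ k * k ^ (γ * k)
          ≤⟨ ℕₚ.*-mono-≤ (ℕₚ.*-mono-≤ B≤ (ℕₚ.^-monoˡ-≤ k ℓ≤))
               (ℕₚ.^-monoʳ-≤ k {{ℕₚ.m^n≢0 2 D}} (ℕₚ.*-monoˡ-≤ k (2^-cancel-≤ γ D 2^γ≤))) ⟩
        2 ^ k * (2 ^ D) ^ k * (2 ^ D) ^ (D * k)
          ≡⟨ cong₂ (λ x y → 2 ^ k * x * y) (ℕₚ.^-*-assoc 2 D k) (ℕₚ.^-*-assoc 2 D (D * k)) ⟩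
        2 ^ k * 2 ^ (D * k) * 2 ^ (D * (D * k))
          ≡⟨ cong (_* 2 ^ (D * (D * k))) (sym (ℕₚ.^-distribˡ-+-* 2 k (D * k))) ⟩
        2 ^ (k + D * k) * 2 ^ (D * (D * k))
          ≡⟨ sym (ℕₚ.^-distribˡ-+-* 2 (k + D * k) (D * (D * k))) ⟩
        2 ^ (k + D * k + D * (D * k))
          ≡⟨ cong (2 ^_) (solve 2 (λ k D → k :+ D :* k :+ D :* (D :* k)
                                    := (con 1 :+ D :+ D :* D) :* k) refl k D) ⟩
        2 ^ ((1 + D + D * D) * k)                  ∎))
    where
    open ℕₚ.≤-Reasoning
    open ℕSolver
    k = 2 ^ D

open import Data.Rational using (_+_; _*_; _-_; -_; ∣_∣; _≤_; _<_)

-- Naturals in the rationals, and powers of one half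

ι : ℕ → ℚ
ι n = ℤ.+ n ℚ./ 1

private
  ι-unnormalised : ∀ n → ℚ.toℚᵘ (ι n) ℚᵘ.≃ mkℚᵘ (ℤ.+ n) 0
  ι-unnormalised n = ℚₚ.toℚᵘ-fromℚᵘ (mkℚᵘ (ℤ.+ n) 0)

ι-+ : ∀ m n → ι (m ℕ.+ n) ≡ ι m + ι n
ι-+ m n = ℚₚ.toℚᵘ-injective (begin
  ℚ.toℚᵘ (ι (m ℕ.+ n))                ≈⟨ ι-unnormalised (m ℕ.+ n) ⟩
  mkℚᵘ (ℤ.+ (m ℕ.+ n)) 0
    ≈⟨ *≡* (cong (ℤ._* ℤ.+ 1) (sym (cong₂ ℤ._+_ (ℤₚ.*-identityʳ (ℤ.+ m)) (ℤₚ.*-identityʳ (ℤ.+ n))))) ⟩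
  mkℚᵘ (ℤ.+ m) 0 ℚᵘ.+ mkℚᵘ (ℤ.+ n) 0
    ≈⟨ ℚᵘₚ.+-cong (ℚᵘₚ.≃-sym (ι-unnormalised m)) (ℚᵘₚ.≃-sym (ι-unnormalised n)) ⟩
  ℚ.toℚᵘ (ι m) ℚᵘ.+ ℚ.toℚᵘ (ι n)      ≈⟨ ℚᵘₚ.≃-sym (ℚₚ.toℚᵘ-homo-+ (ι m) (ι n)) ⟩
  ℚ.toℚᵘ (ι m + ι n)                  ∎)
  where open ℚᵘₚ.≃-Reasoning

ι-* : ∀ m n → ι (m ℕ.* n) ≡ ι m * ι n
ι-* m n = ℚₚ.toℚᵘ-injective (begin
  ℚ.toℚᵘ (ι (m ℕ.* n))                ≈⟨ ι-unnormalised (m ℕ.* n) ⟩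
  mkℚᵘ (ℤ.+ (m ℕ.* n)) 0                ≈⟨ *≡* (cong (ℤ._* ℤ.+ 1) (ℤₚ.pos-* m n)) ⟩
  mkℚᵘ (ℤ.+ m) 0 ℚᵘ.* mkℚᵘ (ℤ.+ n) 0
    ≈⟨ ℚᵘₚ.*-cong (ℚᵘₚ.≃-sym (ι-unnormalised m)) (ℚᵘₚ.≃-sym (ι-unnormalised n)) ⟩
  ℚ.toℚᵘ (ι m) ℚᵘ.* ℚ.toℚᵘ (ι n)      ≈⟨ ℚᵘₚ.≃-sym (ℚₚ.toℚᵘ-homo-* (ι m) (ι n)) ⟩
  ℚ.toℚᵘ (ι m * ι n)                  ∎)
  where open ℚᵘₚ.≃-Reasoning

ι-nonneg : ∀ n → 0ℚ ≤ ι n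
ι-nonneg n = ℚₚ.nonNegative⁻¹ _ {{ℚₚ.normalize-nonNeg n 1}}

ι-mono-≤ : ∀ {m n} → m ℕ.≤ n → ι m ≤ ι n
ι-mono-≤ {m} {n} m≤n = begin
  ι m                      ≡⟨ sym (ℚₚ.+-identityʳ (ι m)) ⟩
  ι m + 0ℚ                 ≤⟨ ℚₚ.+-monoʳ-≤ (ι m) (ι-nonneg (n ℕ.∸ m)) ⟩
  ι m + ι (n ℕ.∸ m)        ≡⟨ sym (ι-+ m (n ℕ.∸ m)) ⟩
  ι (m ℕ.+ (n ℕ.∸ m))      ≡⟨ cong ι (ℕₚ.m+[n∸m]≡n m≤n) ⟩
  ι n                      ∎
  where open ℚₚ.≤-Reasoning

ι-mono-< : ∀ {m n} → m ℕ.< n → ι m < ι n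
ι-mono-< {m} {n} m<n = begin-strict
  ι m            ≡⟨ sym (ℚₚ.+-identityˡ (ι m)) ⟩
  0ℚ + ι m       <⟨ ℚₚ.+-monoˡ-< (ι m) (ℚₚ.positive⁻¹ 1ℚ) ⟩
  1ℚ + ι m       ≡⟨ sym (ι-+ 1 m) ⟩
  ι (suc m)      ≤⟨ ι-mono-≤ m<n ⟩
  ι n            ∎
  where open ℚₚ.≤-Reasoning

ι-cancel-≤ : ∀ {m n} → ι m ≤ ι n → m ℕ.≤ n
ι-cancel-≤ ιm≤ιn = ℕₚ.≮⇒≥ λ n<m → ℚₚ.<-irrefl refl (ℚₚ.<-≤-trans (ι-mono-< n<m) ιm≤ιn)

*-nonneg : ∀ {p q} → 0ℚ ≤ p → 0ℚ ≤ q → 0ℚ ≤ p * q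
*-nonneg {p} {q} 0≤p 0≤q =
  subst (_≤ p * q) (ℚₚ.*-zeroʳ p) (ℚₚ.*-monoˡ-≤-nonNeg p {{ℚ.nonNegative 0≤p}} 0≤q)

+-nonneg : ∀ {p q} → 0ℚ ≤ p → 0ℚ ≤ q → 0ℚ ≤ p + q
+-nonneg = ℚₚ.+-mono-≤

∣∣≤ : ∀ {p b} → - b ≤ p → p ≤ b → ∣ p ∣ ≤ b
∣∣≤ {p} {b} -b≤p p≤b with ℚₚ.∣p∣≡p∨∣p∣≡-p p
... | inj₁ eq = subst (_≤ b) (sym eq) p≤b
... | inj₂ eq = subst₂ _≤_ (sym eq) (solve 1 (λ b → :- (:- b) := b) refl b) (ℚₚ.neg-antimono-≤ -b≤p)
  where open ℚSolver

p≤p+ : ∀ {p q} → 0ℚ ≤ q → p ≤ p + q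
p≤p+ {p} {q} 0≤q = subst (_≤ p + q) (ℚₚ.+-identityʳ p) (ℚₚ.+-monoʳ-≤ p 0≤q)

0≤q-p : ∀ {p q} → p ≤ q → 0ℚ ≤ q - p
0≤q-p {p} {q} p≤q = subst (_≤ q - p) (ℚₚ.+-inverseʳ p) (ℚₚ.+-monoˡ-≤ (- p) p≤q)

0<q-p : ∀ {p q} → p < q → 0ℚ < q - p
0<q-p {p} {q} p<q = subst (_< q - p) (ℚₚ.+-inverseʳ p) (ℚₚ.+-monoˡ-< (- p) p<q)

≤-by-slack : ∀ {p q} → (∀ ε → 0ℚ < ε → p ≤ q + ε) → p ≤ q
≤-by-slack {p} {q} h = ℚₚ.≮⇒≥ λ q<p →
  let r , q<r , r<p = ℚₚ.<-dense q<p in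
  ℚₚ.<-irrefl refl (ℚₚ.≤-<-trans
    (subst (p ≤_) (solve 2 (λ q r → q :+ (r :- q) := r) refl q r) (h (r - q) (0<q-p q<r))) r<p)
  where open ℚSolver

fromℚ-mono-≤ : ∀ {p q} → p ≤ q → fromℚ p ≤ᴿ fromℚ q
fromℚ-mono-≤ p≤q = mk≤ λ ε 0<ε → 0 , λ _ _ → ℚₚ.≤-trans p≤q (p≤p+ (ℚₚ.<⇒≤ 0<ε))

fromℚ-cancel-≤ : ∀ {p q} → fromℚ p ≤ᴿ fromℚ q → p ≤ q
fromℚ-cancel-≤ p≤q = ≤-by-slack λ ε 0<ε → let N , h = below p≤q ε 0<ε in h N ℕₚ.≤-refl

2^-pos : ∀ n → 0ℚ < 2^- n
2^-pos zero    = ℚₚ.positive⁻¹ 1ℚ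
2^-pos (suc n) = half-pos _ (2^-pos n)

2^-suc≤ : ∀ n → 2^- suc n ≤ 2^- n
2^-suc≤ n = subst (½ * 2^- n ≤_) (ℚₚ.*-identityˡ (2^- n))
  (ℚₚ.*-monoʳ-≤-nonNeg (2^- n) {{ℚ.nonNegative (ℚₚ.<⇒≤ (2^-pos n))}} {½} {1ℚ} (ℚ.*≤* (ℤ.+≤+ (s≤s z≤n))))

2^-antitone : ∀ {m n} → m ℕ.≤ n → 2^- n ≤ 2^- m
2^-antitone {n = zero}  z≤n     = ℚₚ.≤-refl
2^-antitone {n = suc n} z≤n     = ℚₚ.≤-trans (2^-suc≤ n) (2^-antitone {0} {n} z≤n)
2^-antitone (s≤s m≤n) = ℚₚ.*-monoˡ-≤-nonNeg ½ (2^-antitone m≤n)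

2^-cancel : ∀ m n → ι (2 ^ m) * 2^- (m ℕ.+ n) ≡ 2^- n
2^-cancel zero    n = ℚₚ.*-identityˡ (2^- n)
2^-cancel (suc m) n = begin
  ι (2 ^ suc m) * (½ * 2^- (m ℕ.+ n))        ≡⟨ cong (_* (½ * 2^- (m ℕ.+ n))) (ι-* 2 (2 ^ m)) ⟩
  (ι 2 * ι (2 ^ m)) * (½ * 2^- (m ℕ.+ n))
    ≡⟨ solve 2 (λ a b → (con (ι 2) :* a) :* (con ½ :* b) := a :* b)
          refl (ι (2 ^ m)) (2^- (m ℕ.+ n)) ⟩
  ι (2 ^ m) * 2^- (m ℕ.+ n)                  ≡⟨ 2^-cancel m n ⟩
  2^- n                                      ∎
  where
  open ≡-Reasoning
  open ℚSolver

-- Binary expansions of rationals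

firstBit : ℚ → Bool
firstBit q = does (½ ℚₚ.≤? q)

remainder : ℚ → ℚ
remainder q = q + q - ι (digit (firstBit q))

-- The right endpoint is included: 1 has first digit 1 and remainder 1, so it expands as 0.111...
Unit : ℚ → Set
Unit q = 0ℚ ≤ q × q ≤ 1ℚ

remainder-unit : ∀ {q} → Unit q → Unit (remainder q)
remainder-unit {q} (0≤q , q≤1) = go (½ ℚₚ.≤? q)
  where
  go : (d : Dec (½ ≤ q)) → Unit (q + q - ι (digit (does d)))
  go (yes ½≤q) = 0≤q-p (ℚₚ.+-mono-≤ ½≤q ½≤q) , ℚₚ.+-monoˡ-≤ (- 1ℚ) (ℚₚ.+-mono-≤ q≤1 q≤1)
  go (no  ½≰q) = 0≤q-p (+-nonneg 0≤q 0≤q) , ℚₚ.+-monoˡ-≤ (- 0ℚ) (ℚₚ.+-mono-≤ q≤½ q≤½)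
    where q≤½ = ℚₚ.<⇒≤ (ℚₚ.≰⇒> ½≰q)

fractionBits : ℕ → ℚ → Word
fractionBits zero    q = []
fractionBits (suc n) q = firstBit q ∷ fractionBits n (remainder q)

length-fractionBits : ∀ n q → length (fractionBits n q) ≡ n
length-fractionBits zero    q = refl
length-fractionBits (suc n) q = cong suc (length-fractionBits n (remainder q))

fraction-fractionBits : ∀ n {q} → Unit q → dist (fraction (fractionBits n q)) q ≤ 2^- n
fraction-fractionBits zero    {q} (0≤q , q≤1) =
  ∣∣≤ (subst (- 1ℚ ≤_) (sym (ℚₚ.+-identityˡ (- q))) (ℚₚ.neg-antimono-≤ q≤1))
      (ℚₚ.≤-trans (subst (_≤ 0ℚ) (sym (ℚₚ.+-identityˡ (- q))) (ℚₚ.neg-antimono-≤ 0≤q))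
                  (ℚₚ.nonNegative⁻¹ 1ℚ))
fraction-fractionBits (suc n) {q} u = begin
  dist (½ * (b + F)) q
    ≡⟨ cong ∣_∣ (solve 3 (λ b F q → con ½ :* (b :+ F) :- q := con ½ :* (F :- (q :+ q :- b)))
          refl b F q) ⟩
  ∣ ½ * (F - remainder q) ∣     ≡⟨ ℚₚ.∣p*q∣≡∣p∣*∣q∣ ½ (F - remainder q) ⟩
  ½ * dist F (remainder q)
    ≤⟨ ℚₚ.*-monoˡ-≤-nonNeg ½ (fraction-fractionBits n (remainder-unit u)) ⟩
  ½ * 2^- n                     ∎
  where
  open ℚₚ.≤-Reasoning
  open ℚSolver
  b = ι (digit (firstBit q))
  F = fraction (fractionBits n (remainder q))

-- K integer digits and n fractional digits of 2ᴷ q, for 0 ≤ q ≤ 1.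
fixedPoint : ℕ → ℕ → ℚ → Word
fixedPoint zero    n q = true ∷ fractionBits n q
fixedPoint (suc K) n q = false ∷ firstBit q ∷ fixedPoint K n (remainder q)

length-fixedPoint : ∀ K n q → length (fixedPoint K n q) ≡ K ℕ.+ K ℕ.+ suc n
length-fixedPoint zero    n q = cong suc (length-fractionBits n q)
length-fixedPoint (suc K) n q = trans
  (cong (λ x → suc (suc x)) (length-fixedPoint K n (remainder q)))
  (cong (λ x → suc (x ℕ.+ suc n)) (sym (ℕₚ.+-suc K K)))

-- The accumulator a holds the integer digits already read. Reading a digit b preserves the number
-- denoted, since 2ᴷ (b + 2a + (2q - b)) = 2ᴷ⁺¹ (a + q), so the only error is that of the n
-- fractional digits.
magnitude-fixedPoint : ∀ K n a {q} → Unit q →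
  dist (magnitude a (fixedPoint K n q)) (ι (2 ^ K) * (ι a + q)) ≤ 2^- n
magnitude-fixedPoint zero    n a {q} u = subst (_≤ 2^- n)
  (cong ∣_∣ (solve 3 (λ a F q → F :- q := (a :+ F) :- con 1ℚ :* (a :+ q))
        refl (ι a) (fraction (fractionBits n q)) q))
  (fraction-fractionBits n u)
  where open ℚSolver
magnitude-fixedPoint (suc K) n a {q} u =
  subst (λ z → dist (magnitude (b ℕ.+ 2 ℕ.* a) (fixedPoint K n (remainder q))) z ≤ 2^- n) eq
    (magnitude-fixedPoint K n (b ℕ.+ 2 ℕ.* a) (remainder-unit u))
  where
  open ≡-Reasoning
  open ℚSolver
  b = digit (firstBit q)
  eq : ι (2 ^ K) * (ι (b ℕ.+ 2 ℕ.* a) + remainder q) ≡ ι (2 ^ suc K) * (ι a + q)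
  eq = begin
    ι (2 ^ K) * (ι (b ℕ.+ 2 ℕ.* a) + remainder q)
      ≡⟨ cong (λ z → ι (2 ^ K) * (z + remainder q))
           (trans (ι-+ b (2 ℕ.* a)) (cong (ι b +_) (ι-* 2 a))) ⟩
    ι (2 ^ K) * ((ι b + ι 2 * ι a) + remainder q)
      ≡⟨ solve 4 (λ p b a q → p :* ((b :+ con (ι 2) :* a) :+ (q :+ q :- b))
                   := (con (ι 2) :* p) :* (a :+ q)) refl (ι (2 ^ K)) (ι b) (ι a) q ⟩
    (ι 2 * ι (2 ^ K)) * (ι a + q)
      ≡⟨ cong (_* (ι a + q)) (sym (ι-* 2 (2 ^ K))) ⟩
    ι (2 ^ suc K) * (ι a + q) ∎

-- The affine functions as Gevrey functions

-- The case c = 0 is the constant 1, so dividend and divisor are treated alike. The value at -1 is 1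
-- for every c.
affineℚ : ℕ → ℚ → ℚ
affineℚ c t = 1ℚ + ι c * (1ℚ + t)

dist-affineℚ : ∀ c s t → dist (affineℚ c s) (affineℚ c t) ≡ ι c * dist s t
dist-affineℚ c s t = begin
  ∣ affineℚ c s - affineℚ c t ∣
    ≡⟨ cong ∣_∣ (solve 3 (λ c s t → (con 1ℚ :+ c :* (con 1ℚ :+ s)) :- (con 1ℚ :+ c :* (con 1ℚ :+ t))
                           := c :* (s :- t)) refl (ι c) s t) ⟩
  ∣ ι c * (s - t) ∣      ≡⟨ ℚₚ.∣p*q∣≡∣p∣*∣q∣ (ι c) (s - t) ⟩
  ∣ ι c ∣ * dist s t     ≡⟨ cong (_* dist s t) (ℚₚ.0≤p⇒∣p∣≡p (ι-nonneg c)) ⟩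
  ι c * dist s t         ∎
  where
  open ≡-Reasoning
  open ℚSolver

affine : ℕ → RealFunction
affine c = record
  { to   = λ x → fromℚ 1ℚ +ᴿ fromℕ c *ᴿ (fromℚ 1ℚ +ᴿ proj₁ x)
  ; cong = λ {x} {y} x≈y → mk≈ λ ε 0<ε →
      -- The factor is `suc c` because c may be 0.
      let δ , 0<δ , eq = shrink (ι (suc c)) (ι-mono-< {0} {suc c} (s≤s z≤n)) ε 0<ε
          N , near     = close x≈y δ 0<δ
      in N , λ n N≤n → stretch (seq (proj₁ x) n) (seq (proj₁ y) n) 0<δ eq (near n N≤n)
  }
  where
  open ℚₚ.≤-Reasoning
  stretch : ∀ s t {δ ε} → 0ℚ < δ → ι (suc c) * δ ≡ ε → dist s t ≤ δ →
            dist (affineℚ c s) (affineℚ c t) ≤ ε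
  stretch s t {δ} {ε} 0<δ eq s≈t = begin
    dist (affineℚ c s) (affineℚ c t) ≡⟨ dist-affineℚ c s t ⟩
    ι c * dist s t
      ≤⟨ *-mono-nonneg (ι-nonneg c) (ℚₚ.<⇒≤ 0<δ) (ι-mono-≤ (ℕₚ.n≤1+n c)) s≈t ⟩
    ι (suc c) * δ                    ≡⟨ eq ⟩
    ε                                ∎

constantFunction : ℚ → RealFunction
constantFunction q = record { to = λ _ → fromℚ q ; cong = λ {x} {y} _ → ≈ᴿ-refl {fromℚ q} }

∣0∣≤ : ∀ {z b ε} → z ≡ 0ℚ → 0ℚ ≤ b → 0ℚ < ε → ∣ z ∣ ≤ b + ε
∣0∣≤ refl 0≤b 0<ε = +-nonneg 0≤b (ℚₚ.<⇒≤ 0<ε)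

affine-smooth : ∀ c → InfinitelyDifferentiable (affine c)
affine-smooth c = record { deriv = D ; deriv-zero = λ x → ≈ᴿ-refl {affine c ⟨$⟩ x} ; deriv-suc = D′ }
  where
  open ℚSolver
  D : ℕ → RealFunction
  D 0             = affine c
  D 1             = constantFunction (ι c)
  D (suc (suc k)) = constantFunction 0ℚ
  D′ : ∀ k → HasDerivative (D k) (D (suc k))
  -- All linear approximations below are exact, so δ = 1 serves every ε.
  D′ 0 x ε 0<ε = 1ℚ , ℚₚ.positive⁻¹ 1ℚ , λ y _ → mk≤ λ η 0<η → 0 , λ n _ →
    ∣0∣≤ (solve 3 (λ c s t →
            (con 1ℚ :+ c :* (con 1ℚ :+ t)) :- (con 1ℚ :+ c :* (con 1ℚ :+ s)) :- c :* (t :- s)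
              := con 0ℚ)
            refl (ι c) (seq (proj₁ x) n) (seq (proj₁ y) n))
      (*-nonneg (ℚₚ.<⇒≤ 0<ε) (ℚₚ.0≤∣p∣ (seq (proj₁ y) n - seq (proj₁ x) n))) 0<η
  D′ 1 x ε 0<ε = 1ℚ , ℚₚ.positive⁻¹ 1ℚ , λ y _ → mk≤ λ η 0<η → 0 , λ n _ →
    ∣0∣≤ (solve 2 (λ c h → c :- c :- con 0ℚ :* h := con 0ℚ)
            refl (ι c) (seq (proj₁ y) n - seq (proj₁ x) n))
      (*-nonneg (ℚₚ.<⇒≤ 0<ε) (ℚₚ.0≤∣p∣ (seq (proj₁ y) n - seq (proj₁ x) n))) 0<η
  D′ (suc (suc k)) x ε 0<ε = 1ℚ , ℚₚ.positive⁻¹ 1ℚ , λ y _ → mk≤ λ η 0<η → 0 , λ n _ →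
    ∣0∣≤ (solve 1 (λ h → con 0ℚ :- con 0ℚ :- con 0ℚ :* h := con 0ℚ)
            refl (seq (proj₁ y) n - seq (proj₁ x) n))
      (*-nonneg (ℚₚ.<⇒≤ 0<ε) (ℚₚ.0≤∣p∣ (seq (proj₁ y) n - seq (proj₁ x) n))) 0<η

-- Terms t of a real in [-1,1] need not lie in [-1,1]; eventually ∣ 1 + t ∣ ≤ 3.
affineℚ-bound : ∀ {c K t} → 1 ℕ.+ c ℕ.* 3 ℕ.≤ 2 ^ K → ∣ 1ℚ + t ∣ ≤ ι 3 → ∣ affineℚ c t ∣ ≤ ι (2 ^ K)
affineℚ-bound {c} {K} {t} c≤ t≤ = begin
  ∣ 1ℚ + ι c * (1ℚ + t) ∣      ≤⟨ ℚₚ.∣p+q∣≤∣p∣+∣q∣ 1ℚ (ι c * (1ℚ + t)) ⟩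
  1ℚ + ∣ ι c * (1ℚ + t) ∣
    ≡⟨ cong (1ℚ +_) (trans (ℚₚ.∣p*q∣≡∣p∣*∣q∣ (ι c) (1ℚ + t))
         (cong (_* ∣ 1ℚ + t ∣) (ℚₚ.0≤p⇒∣p∣≡p (ι-nonneg c)))) ⟩
  1ℚ + ι c * ∣ 1ℚ + t ∣
    ≤⟨ ℚₚ.+-monoʳ-≤ 1ℚ (ℚₚ.*-monoˡ-≤-nonNeg (ι c) {{ℚ.nonNegative (ι-nonneg c)}} t≤) ⟩
  1ℚ + ι c * ι 3               ≡⟨ cong (1ℚ +_) (sym (ι-* c 3)) ⟩
  1ℚ + ι (c ℕ.* 3)             ≡⟨ sym (ι-+ 1 (c ℕ.* 3)) ⟩
  ι (1 ℕ.+ c ℕ.* 3)            ≤⟨ ι-mono-≤ c≤ ⟩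
  ι (2 ^ K)                  ∎
  where open ℚₚ.≤-Reasoning

private
  ≤ᴿ-bound : ∀ {x} b → (∀ n → ∣ seq x n ∣ ≤ b) → ∣ x ∣ᴿ ≤ᴿ fromℚ b
  ≤ᴿ-bound b h = mk≤ λ ε 0<ε → 0 , λ n _ → ℚₚ.≤-trans (h n) (p≤p+ (ℚₚ.<⇒≤ 0<ε))

  ^*1*1 : ∀ K → 2 ^ K ℕ.* 1 ℕ.* 1 ≡ 2 ^ K
  ^*1*1 K = trans (ℕₚ.*-identityʳ (2 ^ K ℕ.* 1)) (ℕₚ.*-identityʳ (2 ^ K))

-- Only the orders 0 and 1 are nonzero, so a large slope can be charged to `B` entirely, with `ℓ`
-- and `γ` equal to 1.
affine-gevrey : ∀ {c K} → 1 ℕ.+ c ℕ.* 3 ℕ.≤ 2 ^ K → GevreyBound (affine-smooth c) (2 ^ K) 1 1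
affine-gevrey {c} {K} c≤ zero (x , -1≤x , x≤1) = mk≤ λ ε 0<ε → eventually₂
  {λ n → - 1ℚ ≤ seq x n + 1ℚ} {λ n → seq x n ≤ 1ℚ + 1ℚ}
  (λ n l u → ℚₚ.≤-trans (affineℚ-bound {c} {K} {seq x n} c≤
     (∣∣≤ (ℚₚ.≤-trans (ℚₚ.neg-antimono-≤ (ι-mono-≤ {1} {3} (s≤s z≤n)))
            (subst (- 1ℚ ≤_) (ℚₚ.+-comm (seq x n) 1ℚ) l))
          (ℚₚ.+-monoʳ-≤ 1ℚ u)))
     (subst (λ z → ι (2 ^ K) ≤ ι z + ε) (sym (^*1*1 K)) (p≤p+ (ℚₚ.<⇒≤ 0<ε))))
  (below -1≤x 1ℚ (ℚₚ.positive⁻¹ 1ℚ)) (below x≤1 1ℚ (ℚₚ.positive⁻¹ 1ℚ))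
affine-gevrey {c} {K} c≤ 1 x = ≤ᴿ-bound {fromℚ (ι c)} _ λ n → ℚₚ.≤-trans
  (ℚₚ.≤-reflexive (ℚₚ.0≤p⇒∣p∣≡p (ι-nonneg c)))
  (ι-mono-≤ (ℕₚ.≤-trans (ℕₚ.≤-trans (ℕₚ.≤-trans (ℕₚ.m≤m*n c 3) (ℕₚ.n≤1+n _)) c≤)
     (ℕₚ.≤-reflexive (sym (^*1*1 K)))))
affine-gevrey {K = K} c≤ (suc (suc k)) x = ≤ᴿ-bound {fromℚ 0ℚ} _ λ n →
  ι-nonneg (2 ^ K ℕ.* 1 ^ suc (suc k) ℕ.* suc (suc k) ^ (1 ℕ.* suc (suc k)))

affineGevrey : ∀ {c K} → 1 ℕ.+ c ℕ.* 3 ℕ.≤ 2 ^ K → GevreyFunction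
affineGevrey {c} {K} c≤ = record
  { function = affine c
  ; smooth   = affine-smooth c
  ; gevrey   = 2 ^ K , 1 , 1 , ℕₚ.m^n>0 2 K , s≤s z≤n , s≤s z≤n , affine-gevrey {c} {K} c≤
  }

-- Short names of the affine functions

unpair : Word → Word
unpair (false ∷ b ∷ w) = b ∷ unpair w
unpair _               = []

unpair-pair : ∀ u v → unpair (pair u v) ≡ u
unpair-pair []      v = refl
unpair-pair (b ∷ u) v = cong (b ∷_) (unpair-pair u v)

length-pair : ∀ u v → length v ℕ.≤ length (pair u v)
length-pair []      v = ℕₚ.n≤1+n _
length-pair (b ∷ u) v = ℕₚ.≤-trans (length-pair u v) (ℕₚ.≤-trans (ℕₚ.n≤1+n _) (ℕₚ.n≤1+n _))

binaryFrom-zeros : ∀ a n → binaryFrom a (zeros n) ≡ 2 ^ n ℕ.* a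
binaryFrom-zeros a zero    = sym (ℕₚ.+-identityʳ a)
binaryFrom-zeros a (suc n) = trans (binaryFrom-zeros (2 ℕ.* a) n)
  (solve 2 (λ p a → p :* (con 2 :* a) := (con 2 :* p) :* a) refl (2 ^ n) a)
  where open ℕSolver

size-tuple : ∀ {n} (φs : Fin n → 𝓜) m → size (tuple φs) m ℕ.≤ suc (maxSize φs m)
size-tuple {n} φs m with ℕₚ.≤-<-connex ⌈log₂ n ⌉ (length (zeros m))
... | inj₂ m<c rewrite tupleFun-short φs (zeros m) m<c = z≤n
... | inj₁ c≤m = begin
  size (tuple φs) m                                    ≡⟨ length-tupleFun φs (zeros m) c≤m ⟩
  suc (maxSize φs (length (zeros m) ℕ.∸ ⌈log₂ n ⌉))
    ≤⟨ s≤s (maxSize-mono φs (ℕₚ.m∸n≤m _ ⌈log₂ n ⌉)) ⟩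
  suc (maxSize φs (length (zeros m)))
    ≡⟨ cong (λ k → suc (maxSize φs k)) (length-replicate m) ⟩
  suc (maxSize φs m)                                   ∎
  where open ℕₚ.≤-Reasoning

module _ (c K : ℕ) where

  scaledValue : Word → ℚ
  scaledValue u = 2^- K * affineℚ c (dyadic u)

  -- The fixed width makes the output length depend on the length of w alone, as monotonicity
  -- demands; arguments outside [-1,1] get digits without meaning but of the right number. The first
  -- bit is the sign. For w = `pair u v`, the length of w is at least that of v, so the precision
  -- suffices.
  affineNameFun : Word → Word
  affineNameFun w = false ∷ fixedPoint K (length w) (scaledValue (unpair w))

  length-affineNameFun : ∀ w → length (affineNameFun w) ≡ suc (K ℕ.+ K ℕ.+ suc (length w))
  length-affineNameFun w = cong suc (length-fixedPoint K (length w) (scaledValue (unpair w)))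

  affineName : 𝓜
  affineName = record
    { fun      = affineNameFun
    ; monotone = λ u v u≤v → subst₂ ℕ._≤_ (sym (length-affineNameFun u)) (sym (length-affineNameFun v))
        (s≤s (ℕₚ.+-monoʳ-≤ (K ℕ.+ K) (s≤s u≤v)))
    }

  size-affineName : ∀ n → size affineName n ≡ suc (K ℕ.+ K ℕ.+ suc n)
  size-affineName n = trans (length-affineNameFun (zeros n))
    (cong (λ m → suc (K ℕ.+ K ℕ.+ suc m)) (length-replicate n))

  scaledValue-unit : 1 ℕ.+ c ℕ.* 3 ℕ.≤ 2 ^ K → ∀ u → fromℚ (dyadic u) ∈[-1,1] → Unit (scaledValue u)
  scaledValue-unit c≤ u (-1≤u , u≤1) =
    *-nonneg 0≤2^-K (+-nonneg (ℚₚ.nonNegative⁻¹ 1ℚ) (*-nonneg (ι-nonneg c) 0≤1+t)) ,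
    (begin
      2^- K * affineℚ c t     ≤⟨ ℚₚ.*-monoˡ-≤-nonNeg (2^- K) {{ℚ.nonNegative 0≤2^-K}}
                                   (ℚₚ.≤-trans (≤-abs (affineℚ c t))
                                     (affineℚ-bound {c} {K} {t} c≤ ∣1+t∣≤3)) ⟩
      2^- K * ι (2 ^ K)       ≡⟨ ℚₚ.*-comm (2^- K) (ι (2 ^ K)) ⟩
      ι (2 ^ K) * 2^- K       ≡⟨ cong (λ k → ι (2 ^ K) * 2^- k) (sym (ℕₚ.+-identityʳ K)) ⟩
      ι (2 ^ K) * 2^- (K ℕ.+ 0) ≡⟨ 2^-cancel K 0 ⟩
      1ℚ                      ∎)
    where
    open ℚₚ.≤-Reasoning
    t = dyadic u
    0≤2^-K = ℚₚ.<⇒≤ (2^-pos K)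
    0≤1+t : 0ℚ ≤ 1ℚ + t
    0≤1+t = ℚₚ.+-monoʳ-≤ 1ℚ (fromℚ-cancel-≤ { - 1ℚ} {t} record { below = below -1≤u })
    ∣1+t∣≤3 : ∣ 1ℚ + t ∣ ≤ ι 3
    ∣1+t∣≤3 = ℚₚ.≤-trans (ℚₚ.≤-reflexive (ℚₚ.0≤p⇒∣p∣≡p 0≤1+t))
      (ℚₚ.≤-trans (ℚₚ.+-monoʳ-≤ 1ℚ (fromℚ-cancel-≤ u≤1)) (ι-mono-≤ {2} {3} (s≤s (s≤s z≤n))))

  scaledValue-unscale : ∀ u → ι (2 ^ K) * (0ℚ + scaledValue u) ≡ affineℚ c (dyadic u)
  scaledValue-unscale u = begin
    ι (2 ^ K) * (0ℚ + 2^- K * A)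
      ≡⟨ solve 3 (λ p m a → p :* (con 0ℚ :+ m :* a) := (p :* m) :* a) refl (ι (2 ^ K)) (2^- K) A ⟩
    (ι (2 ^ K) * 2^- K) * A
      ≡⟨ cong (λ k → (ι (2 ^ K) * 2^- k) * A) (sym (ℕₚ.+-identityʳ K)) ⟩
    (ι (2 ^ K) * 2^- (K ℕ.+ 0)) * A   ≡⟨ cong (_* A) (2^-cancel K 0) ⟩
    1ℚ * A                            ≡⟨ ℚₚ.*-identityˡ A ⟩
    A                                 ∎
    where
    open ≡-Reasoning
    open ℚSolver
    A = affineℚ c (dyadic u)

  affineName-isFunName : 1 ℕ.+ c ℕ.* 3 ℕ.≤ 2 ^ K → IsFunName affineName (affine c)
  affineName-isFunName c≤ = approximates , modulus
    where
    approximates : ∀ u v (p : fromℚ (dyadic u) ∈[-1,1]) →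
      ∣ fromℚ (dyadic (affineNameFun (pair u v))) -ᴿ (affine c ⟨$⟩ (fromℚ (dyadic u) , p)) ∣ᴿ
        ≤ᴿ fromℚ (2^- length v)
    approximates u v p = mk≤ λ ε 0<ε → 0 , λ _ _ → ℚₚ.≤-trans error (p≤p+ (ℚₚ.<⇒≤ 0<ε))
      where
      open ℚₚ.≤-Reasoning
      m = length (pair u v)
      error : dist (magnitude 0 (fixedPoint K m (scaledValue (unpair (pair u v)))))
                   (affineℚ c (dyadic u)) ≤ 2^- length v
      error = begin
        dist (magnitude 0 (fixedPoint K m (scaledValue (unpair (pair u v))))) (affineℚ c (dyadic u))
          ≡⟨ cong₂ (λ x y → dist (magnitude 0 (fixedPoint K m (scaledValue x))) y)
               (unpair-pair u v) (sym (scaledValue-unscale u)) ⟩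
        dist (magnitude 0 (fixedPoint K m (scaledValue u))) (ι (2 ^ K) * (ι 0 + scaledValue u))
          ≤⟨ magnitude-fixedPoint K m 0 (scaledValue-unit c≤ u p) ⟩
        2^- m            ≤⟨ 2^-antitone (length-pair u v) ⟩
        2^- length v     ∎

    -- The length of a name doubles as its modulus of continuity: a slope of at most 2ᴷ costs K
    -- bits, which the integer digits provide.
    K+n≤size : ∀ n → K ℕ.+ n ℕ.≤ size affineName n
    K+n≤size n = begin
      K ℕ.+ n                            ≤⟨ ℕₚ.m≤m+n (K ℕ.+ n) (2 ℕ.+ K) ⟩
      K ℕ.+ n ℕ.+ (2 ℕ.+ K)
        ≡⟨ solve 2 (λ K n → K :+ n :+ (con 2 :+ K) := con 1 :+ (K :+ K :+ (con 1 :+ n))) refl K n ⟩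
      suc (K ℕ.+ K ℕ.+ suc n)            ≡⟨ sym (size-affineName n) ⟩
      size affineName n                  ∎
      where
      open ℕₚ.≤-Reasoning
      open ℕSolver

    c≤2^K : c ℕ.≤ 2 ^ K
    c≤2^K = ℕₚ.≤-trans (ℕₚ.m≤m*n c 3) (ℕₚ.≤-trans (ℕₚ.n≤1+n _) c≤)

    modulus : ∀ (x y : Point𝕀) n →
      ∣ proj₁ x -ᴿ proj₁ y ∣ᴿ <ᴿ fromℚ (2^- size affineName n) →
      ∣ (affine c ⟨$⟩ x) -ᴿ (affine c ⟨$⟩ y) ∣ᴿ <ᴿ fromℚ (2^- n)
    -- The strict inequality needs a positive gap, so the old gap is scaled by 2ᴷ and not by c,
    -- which may be 0.
    modulus x y n x≈y = mk< (ι (2 ^ K) * g)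
      (*-pos (ι (2 ^ K)) g (ι-mono-< (ℕₚ.m^n>0 2 K)) (gap-pos x≈y))
      (proj₁ (apart x≈y) , λ m M≤m →
        stretch (seq (proj₁ x) m) (seq (proj₁ y) m) (proj₂ (apart x≈y) m M≤m))
      where
      open ℚₚ.≤-Reasoning
      g = gap x≈y
      stretch : ∀ s t → dist s t + g ≤ 2^- size affineName n →
                dist (affineℚ c s) (affineℚ c t) + ι (2 ^ K) * g ≤ 2^- n
      stretch s t s≈t = begin
        dist (affineℚ c s) (affineℚ c t) + ι (2 ^ K) * g
          ≡⟨ cong (_+ ι (2 ^ K) * g) (dist-affineℚ c s t) ⟩
        ι c * dist s t + ι (2 ^ K) * g
          ≤⟨ ℚₚ.+-monoˡ-≤ (ι (2 ^ K) * g)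
               (ℚₚ.*-monoʳ-≤-nonNeg (dist s t) {{ℚ.nonNegative (ℚₚ.0≤∣p∣ (s - t))}} (ι-mono-≤ c≤2^K)) ⟩
        ι (2 ^ K) * dist s t + ι (2 ^ K) * g
          ≡⟨ sym (ℚₚ.*-distribˡ-+ (ι (2 ^ K)) (dist s t) g) ⟩
        ι (2 ^ K) * (dist s t + g)
          ≤⟨ ℚₚ.*-monoˡ-≤-nonNeg (ι (2 ^ K)) {{ℚ.nonNegative (ι-nonneg (2 ^ K))}}
               (ℚₚ.≤-trans s≈t (2^-antitone (K+n≤size n))) ⟩
        ι (2 ^ K) * 2^- (K ℕ.+ n)
          ≡⟨ 2^-cancel K n ⟩
        2^- n ∎

  components : Vec 𝓜 4
  components = affineName ∷ constant (true ∷ zeros K) ∷ constant (zeros 1) ∷ constant (zeros (2 ^ 1)) ∷ []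

  gevreyName : 𝓜
  gevreyName = tuple (Vec.lookup components)

  gevreyName-isName : (c≤ : 1 ℕ.+ c ℕ.* 3 ℕ.≤ 2 ^ K) → IsGevreyName gevreyName (affineGevrey {c} {K} c≤)
  gevreyName-isName c≤ = record
    { funName   = affineName
    ; isFunName = affineName-isFunName c≤
    ; B         = 2 ^ K
    ; ℓ         = 1
    ; γ         = 1
    ; 0<B       = ℕₚ.m^n>0 2 K
    ; 0<ℓ       = s≤s z≤n
    ; 0<γ       = s≤s z≤n
    ; bound     = affine-gevrey {c} {K} c≤
    ; digits    = zeros K
    ; B-binary  = trans (binaryFrom-zeros 1 K) (ℕₚ.*-identityʳ (2 ^ K))
    ; isTuple   = λ _ → refl
    }

  size-gevreyName : ∀ n → size gevreyName n ℕ.≤ 3 ℕ.+ (K ℕ.+ K) ℕ.+ n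
  size-gevreyName n = ℕₚ.≤-trans (size-tuple (Vec.lookup components) n) (s≤s (⊔-lub
    (≤-reflexive (trans (size-affineName n) (cong suc (ℕₚ.+-suc (K ℕ.+ K) n))))
    (⊔-lub (≤-trans (≤-reflexive (cong suc (length-replicate K)))
                    (s≤s (≤-trans (ℕₚ.m≤m+n K K) (≤-trans (ℕₚ.m≤m+n (K ℕ.+ K) n) (ℕₚ.n≤1+n _)))))
    (⊔-lub (s≤s z≤n) (⊔-lub (s≤s (s≤s z≤n)) z≤n)))))
    where open ℕₚ using (⊔-lub; ≤-trans; ≤-reflexive)

-- Differentiating a linear relation

∣+∣≤ : ∀ {a b x y} → ∣ a ∣ ≤ x → ∣ b ∣ ≤ y → ∣ a + b ∣ ≤ x + y
∣+∣≤ {a} {b} a≤ b≤ = ℚₚ.≤-trans (ℚₚ.∣p+q∣≤∣p∣+∣q∣ a b) (ℚₚ.+-mono-≤ a≤ b≤)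

∣-∣≤ : ∀ {a b x y} → ∣ a ∣ ≤ x → ∣ b ∣ ≤ y → ∣ a - b ∣ ≤ x + y
∣-∣≤ {a} {b} a≤ b≤ = ∣+∣≤ {a} { - b} a≤ (subst (_≤ _) (sym (ℚₚ.∣-p∣≡∣p∣ b)) b≤)

∣*∣≤ : ∀ {a b x y} → ∣ a ∣ ≤ x → ∣ b ∣ ≤ y → ∣ a * b ∣ ≤ x * y
∣*∣≤ {a} {b} {x} {y} a≤ b≤ = subst (_≤ x * y) (sym (ℚₚ.∣p*q∣≡∣p∣*∣q∣ a b))
  (*-mono-nonneg (ℚₚ.0≤∣p∣ a) (ℚₚ.≤-trans (ℚₚ.0≤∣p∣ b) b≤) a≤ b≤)

-- The error terms divided by ε h: 2 from the relation at x and at x + h, 2W and 2κ from the linear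
-- approximations of A and B, and N K from the second-order term N h² A′.
leibnizConstant : ℚ → ℚ → ℚ → ℚ → ℚ
leibnizConstant W N κ K = ((1ℚ + 1ℚ) + W * (1ℚ + 1ℚ)) + κ * (1ℚ + 1ℚ) + N * K

-- The relations at x and x + h differ by h times the Leibniz combination, up to
-- the remainders of the linear approximations of A and B.
leibniz-estimate : ∀ {G N κ e h ε W K Ax Ay A′ Bx By B′} →
  0ℚ < h → h ≤ ε → 0ℚ ≤ N → 0ℚ ≤ κ → ∣ G + N * h ∣ ≤ W → ∣ A′ ∣ ≤ K →
  ∣ Ay - Ax - A′ * h ∣ ≤ ε * h + ε * h → ∣ By - Bx - B′ * h ∣ ≤ ε * h + ε * h →
  ∣ (G * Ax + κ * Bx) - e ∣ ≤ ε * h → ∣ ((G + N * h) * Ay + κ * By) - e ∣ ≤ ε * h →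
  ∣ G * A′ + N * Ax + κ * B′ ∣ ≤ leibnizConstant W N κ K * ε
leibniz-estimate {G} {N} {κ} {e} {h} {ε} {W} {K} {Ax} {Ay} {A′} {Bx} {By} {B′}
  0<h h≤ε 0≤N 0≤κ W≥ K≥ RA RB Ex Ey =
  ℚₚ.*-cancelˡ-≤-pos h {{ℚ.positive 0<h}} (begin
    h * ∣ Z ∣               ≡⟨ cong (_* ∣ Z ∣) (sym ∣h∣≡h) ⟩
    ∣ h ∣ * ∣ Z ∣           ≡⟨ sym (ℚₚ.∣p*q∣≡∣p∣*∣q∣ h Z) ⟩
    ∣ h * Z ∣               ≡⟨ cong ∣_∣ expand ⟩
    ∣ ey - ex - (G + N * h) * ra - κ * rb - N * (h * (h * A′)) ∣
      ≤⟨ ∣-∣≤ {ey - ex - (G + N * h) * ra - κ * rb} {N * (h * (h * A′))}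
          (∣-∣≤ {ey - ex - (G + N * h) * ra} {κ * rb}
            (∣-∣≤ {ey - ex} {(G + N * h) * ra} (∣-∣≤ {ey} {ex} Ey Ex) (∣*∣≤ {G + N * h} {ra} W≥ RA))
            (∣*∣≤ {κ} {rb} (abs-id 0≤κ) RB))
          (∣*∣≤ {N} {h * (h * A′)} (abs-id 0≤N) (∣*∣≤ {h} {h * A′} (abs-id (ℚₚ.<⇒≤ 0<h))
            (∣*∣≤ {h} {A′} (ℚₚ.≤-trans (abs-id (ℚₚ.<⇒≤ 0<h)) h≤ε) K≥))) ⟩
    (ε * h + ε * h) + W * (ε * h + ε * h) + κ * (ε * h + ε * h) + N * (h * (ε * K))
      ≡⟨ solve 6 (λ ε h W κ N K →
           (ε :* h :+ ε :* h) :+ W :* (ε :* h :+ ε :* h) :+ κ :* (ε :* h :+ ε :* h)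
             :+ N :* (h :* (ε :* K))
           := h :* ((((con 1ℚ :+ con 1ℚ) :+ W :* (con 1ℚ :+ con 1ℚ))
                        :+ κ :* (con 1ℚ :+ con 1ℚ) :+ N :* K) :* ε)) refl ε h W κ N K ⟩
    h * (leibnizConstant W N κ K * ε) ∎)
  where
  open ℚₚ.≤-Reasoning
  open ℚSolver
  abs-id : ∀ {p} → 0ℚ ≤ p → ∣ p ∣ ≤ p
  abs-id 0≤p = ℚₚ.≤-reflexive (ℚₚ.0≤p⇒∣p∣≡p 0≤p)
  ∣h∣≡h = ℚₚ.0≤p⇒∣p∣≡p (ℚₚ.<⇒≤ 0<h)
  Z = G * A′ + N * Ax + κ * B′
  ex = (G * Ax + κ * Bx) - e
  ey = ((G + N * h) * Ay + κ * By) - e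
  ra = Ay - Ax - A′ * h
  rb = By - Bx - B′ * h
  first : ∀ G N h Ax Ay A′ →
    (G + N * h) * Ay - G * Ax - (G + N * h) * (Ay - Ax - A′ * h) - N * (h * (h * A′))
      ≡ h * (G * A′ + N * Ax)
  first = solve 6 (λ G N h Ax Ay A′ →
    (G :+ N :* h) :* Ay :- G :* Ax :- (G :+ N :* h) :* (Ay :- Ax :- A′ :* h) :- N :* (h :* (h :* A′))
      := h :* (G :* A′ :+ N :* Ax)) refl
  second : ∀ κ h Bx By B′ → κ * By - κ * Bx - κ * (By - Bx - B′ * h) ≡ h * (κ * B′)
  second = solve 5 (λ κ h Bx By B′ → κ :* By :- κ :* Bx :- κ :* (By :- Bx :- B′ :* h)
                     := h :* (κ :* B′)) refl
  regroup : ∀ p q r s t u v e → ((p + q) - e) - ((r + s) - e) - t - u - v ≡ (p - r - t - v) + (q - s - u)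
  regroup = solve 8 (λ p q r s t u v e →
    ((p :+ q) :- e) :- ((r :+ s) :- e) :- t :- u :- v := (p :- r :- t :- v) :+ (q :- s :- u)) refl
  expand : h * Z ≡ ey - ex - (G + N * h) * ra - κ * rb - N * (h * (h * A′))
  expand = sym (trans
    (regroup ((G + N * h) * Ay) (κ * By) (G * Ax) (κ * Bx)
             ((G + N * h) * ra) (κ * rb) (N * (h * (h * A′))) e)
    (trans (cong₂ _+_ (first G N h Ax Ay A′) (second κ h Bx By B′))
           (sym (ℚₚ.*-distribˡ-+ h (G * A′ + N * Ax) (κ * B′)))))

half< : ∀ {s} → 0ℚ < s → ½ * s < s
half< {s} 0<s = subst₂ _<_ (ℚₚ.+-identityˡ (½ * s)) (halves s) (ℚₚ.+-monoˡ-< (½ * s) (half-pos s 0<s))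

below-both : ∀ {p q} → 0ℚ < p → 0ℚ < q → ∃[ r ] (0ℚ < r × r < p × r < q)
below-both {p} {q} 0<p 0<q with ℚₚ.≤-total p q
... | inj₁ p≤q = ½ * p , half-pos p 0<p , half< 0<p , ℚₚ.<-≤-trans (half< 0<p) p≤q
... | inj₂ q≤p = ½ * q , half-pos q 0<q , ℚₚ.<-≤-trans (half< 0<q) q≤p , half< 0<q

below-five : ∀ {p q r s t} → 0ℚ < p → 0ℚ < q → 0ℚ < r → 0ℚ < s → 0ℚ < t →
             ∃[ h ] (0ℚ < h × h < p × h < q × h < r × h < s × h < t)
below-five 0<p 0<q 0<r 0<s 0<t
  with below-both 0<p 0<q | below-both 0<r 0<s
... | a , 0<a , a<p , a<q | b , 0<b , b<r , b<s
  with below-both 0<a 0<b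
... | d , 0<d , d<a , d<b
  with below-both 0<d 0<t
... | h , 0<h , h<d , h<t = h , 0<h ,
  <-trans h<d (<-trans d<a a<p) , <-trans h<d (<-trans d<a a<q) ,
  <-trans h<d (<-trans d<b b<r) , <-trans h<d (<-trans d<b b<s) , h<t
  where open ℚₚ using (<-trans)

leibnizConstant-pos : ∀ {W N κ K} → 0ℚ ≤ W → 0ℚ ≤ N → 0ℚ ≤ κ → 0ℚ ≤ K → 0ℚ < leibnizConstant W N κ K
leibnizConstant-pos 0≤W 0≤N 0≤κ 0≤K = ℚₚ.<-≤-trans (ℚₚ.positive⁻¹ (1ℚ + 1ℚ))
  (ℚₚ.≤-trans (p≤p+ (*-nonneg 0≤W 0≤2)) (ℚₚ.≤-trans (p≤p+ (*-nonneg 0≤κ 0≤2)) (p≤p+ (*-nonneg 0≤N 0≤K))))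
  where
  0≤2 : 0ℚ ≤ 1ℚ + 1ℚ
  0≤2 = ℚₚ.nonNegative⁻¹ (1ℚ + 1ℚ)

fromℚ-∈ : ∀ {q} → - 1ℚ ≤ q → q ≤ 1ℚ → fromℚ q ∈[-1,1]
fromℚ-∈ {q} -1≤q q≤1 = mk≤ (below (fromℚ-mono-≤ { - 1ℚ} {q} -1≤q)) , fromℚ-mono-≤ q≤1

∈⇒-1≤ : ∀ {q} → fromℚ q ∈[-1,1] → - 1ℚ ≤ q
∈⇒-1≤ {q} (-1≤q , _) = fromℚ-cancel-≤ { - 1ℚ} {q} (mk≤ (below -1≤q))

-- Restricted to rational points below 1: these suffice for derivatives, since
-- every such point x comes with further such points x + h.
LinearRelation : ℕ → ℚ → ℚ → RealFunction → RealFunction → Set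
LinearRelation c κ e A B = ∀ q (p : fromℚ q ∈[-1,1]) → q < 1ℚ →
  fromℚ (affineℚ c q) *ᴿ (A ⟨$⟩ (fromℚ q , p)) +ᴿ fromℚ κ *ᴿ (B ⟨$⟩ (fromℚ q , p)) ≈ᴿ fromℚ e

module _ (c : ℕ) (κ e : ℚ) (0≤κ : 0ℚ ≤ κ) {A A′ B B′ : RealFunction}
         (dA : HasDerivative A A′) (dB : HasDerivative B B′) (relation : LinearRelation c κ e A B)
         (q : ℚ) (p : fromℚ q ∈[-1,1]) (q<1 : q < 1ℚ) where

  private
    open ℚSolver

    x : Point𝕀
    x = fromℚ q , p

    G N W : ℚ
    G = affineℚ c q
    N = ι c
    W = ∣ G ∣ + N

    q+h-q : ∀ h → q + h - q ≡ h
    q+h-q = solve 2 (λ q h → q :+ h :- q := h) refl q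

    ∣q+h-q∣ : ∀ h → 0ℚ < h → ∣ q + h - q ∣ ≡ h
    ∣q+h-q∣ h 0<h = trans (cong ∣_∣ (q+h-q h)) (ℚₚ.0≤p⇒∣p∣≡p (ℚₚ.<⇒≤ 0<h))

    near : ∀ h δ → 0ℚ < h → h < δ → ∣ fromℚ (q + h) -ᴿ fromℚ q ∣ᴿ <ᴿ fromℚ δ
    near h δ 0<h h<δ = mk< (δ - h) (0<q-p h<δ) (0 , λ _ _ → ℚₚ.≤-reflexive
      (trans (cong (_+ (δ - h)) (∣q+h-q∣ h 0<h)) (solve 2 (λ h d → h :+ (d :- h) := d) refl h δ)))

    increment : ∀ h → 0ℚ < h → ∀ d a ε →
                ∣ d - a * (q + h - q) ∣ ≤ ε * ∣ q + h - q ∣ + ε * h → ∣ d - a * h ∣ ≤ ε * h + ε * h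
    increment h 0<h d a ε = subst₂ (λ u v → ∣ d - a * u ∣ ≤ ε * v + ε * h) (q+h-q h) (∣q+h-q∣ h 0<h)

    affine-shift : ∀ h → affineℚ c (q + h) ≡ G + N * h
    affine-shift h = solve 3 (λ c q h → con 1ℚ :+ c :* (con 1ℚ :+ (q :+ h))
                               := (con 1ℚ :+ c :* (con 1ℚ :+ q)) :+ c :* h) refl N q h

    W-bound : ∀ h → 0ℚ < h → h ≤ 1ℚ → ∣ G + N * h ∣ ≤ W
    W-bound h 0<h h≤1 = ∣+∣≤ {G} {N * h} ℚₚ.≤-refl (ℚₚ.≤-trans
      (ℚₚ.≤-reflexive (ℚₚ.0≤p⇒∣p∣≡p (*-nonneg (ι-nonneg c) (ℚₚ.<⇒≤ 0<h))))
      (subst (N * h ≤_) (ℚₚ.*-identityʳ N) (ℚₚ.*-monoˡ-≤-nonNeg N {{ℚ.nonNegative (ι-nonneg c)}} h≤1)))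

    combination : ℝ
    combination = fromℚ G *ᴿ (A′ ⟨$⟩ x) +ᴿ fromℚ N *ᴿ (A ⟨$⟩ x) +ᴿ fromℚ κ *ᴿ (B′ ⟨$⟩ x)

    estimate : ∀ {ε h K} → 0ℚ < h → h ≤ ε → h ≤ 1ℚ → (p′ : fromℚ (q + h) ∈[-1,1]) →
      let y = fromℚ (q + h) , p′ in
      (Eventually λ n → ∣ seq (A′ ⟨$⟩ x) n ∣ ≤ K) →
      (Eventually λ n → ∣ seq (A ⟨$⟩ y) n - seq (A ⟨$⟩ x) n - seq (A′ ⟨$⟩ x) n * (q + h - q) ∣
                          ≤ ε * ∣ q + h - q ∣ + ε * h) →
      (Eventually λ n → ∣ seq (B ⟨$⟩ y) n - seq (B ⟨$⟩ x) n - seq (B′ ⟨$⟩ x) n * (q + h - q) ∣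
                          ≤ ε * ∣ q + h - q ∣ + ε * h) →
      (Eventually λ n → dist (G * seq (A ⟨$⟩ x) n + κ * seq (B ⟨$⟩ x) n) e ≤ ε * h) →
      (Eventually λ n → dist (affineℚ c (q + h) * seq (A ⟨$⟩ y) n + κ * seq (B ⟨$⟩ y) n) e ≤ ε * h) →
      Eventually λ n → ∣ seq combination n ∣ ≤ leibnizConstant W N κ K * ε
    estimate {ε} {h} {K} 0<h h≤ε h≤1 p′ bA′ bA bB ex ey = eventually₂
      (λ n (a′ , ra , rb) (ux , uy) → leibniz-estimate {G} {N} {κ} {e} {h} {ε} {W} {K}
        {seq (A ⟨$⟩ x) n} {seq (A ⟨$⟩ (_ , p′)) n} {seq (A′ ⟨$⟩ x) n}
        {seq (B ⟨$⟩ x) n} {seq (B ⟨$⟩ (_ , p′)) n} {seq (B′ ⟨$⟩ x) n}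
        0<h h≤ε (ι-nonneg c) 0≤κ (W-bound h 0<h h≤1) a′
        (increment h 0<h (seq (A ⟨$⟩ (_ , p′)) n - seq (A ⟨$⟩ x) n) (seq (A′ ⟨$⟩ x) n) ε ra)
        (increment h 0<h (seq (B ⟨$⟩ (_ , p′)) n - seq (B ⟨$⟩ x) n) (seq (B′ ⟨$⟩ x) n) ε rb)
        ux
        (subst (λ g → ∣ (g * seq (A ⟨$⟩ (_ , p′)) n + κ * seq (B ⟨$⟩ (_ , p′)) n) - e ∣ ≤ ε * h)
               (affine-shift h) uy))
      (eventually₂ (λ _ → _,_) bA′ (eventually₂ (λ _ → _,_) bA bB)) (eventually₂ (λ _ → _,_) ex ey)

    at-scale : ∀ {K} → (Eventually λ n → ∣ seq (A′ ⟨$⟩ x) n ∣ ≤ K) → ∀ ε → 0ℚ < ε →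
               Eventually λ n → ∣ seq combination n ∣ ≤ leibnizConstant W N κ K * ε
    at-scale {K} bA′ ε 0<ε = go (dA x ε 0<ε) (dB x ε 0<ε)
      where
      go : ∃[ δ ] (0ℚ < δ × _) → ∃[ δ ] (0ℚ < δ × _) → _
      go (δA , 0<δA , near-A) (δB , 0<δB , near-B) =
        -- h < ε tames the term quadratic in h, h < 1 bounds G + N h by W, and h < 1 - q keeps x + h
        -- a point of the relation.
        step (below-five 0<ε (ℚₚ.positive⁻¹ 1ℚ) 0<δA 0<δB (0<q-p q<1))
        where
        step : ∃[ h ] (0ℚ < h × h < ε × h < 1ℚ × h < δA × h < δB × h < 1ℚ - q) → _
        step (h , 0<h , h<ε , h<1 , h<δA , h<δB , h<1-q) =
          -- Every real inequality is read off with tolerance ε h, which survives the division by h.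
          estimate {ε} {h} {K} 0<h (ℚₚ.<⇒≤ h<ε) (ℚₚ.<⇒≤ h<1) p′ bA′
            (below (near-A (fromℚ (q + h) , p′) (near h δA 0<h h<δA)) (ε * h) 0<εh)
            (below (near-B (fromℚ (q + h) , p′) (near h δB 0<h h<δB)) (ε * h) 0<εh)
            (close (relation q p q<1) (ε * h) 0<εh)
            (close (relation (q + h) p′ q+h<1) (ε * h) 0<εh)
          where
          0<εh  = *-pos ε h 0<ε 0<h
          q+h<1 : q + h < 1ℚ
          q+h<1 = subst (q + h <_) (solve 1 (λ q → q :+ (con 1ℚ :- q) := con 1ℚ)
                refl q) (ℚₚ.+-monoʳ-< q h<1-q)
          p′ : fromℚ (q + h) ∈[-1,1]
          p′ = fromℚ-∈ {q + h} (ℚₚ.≤-trans (∈⇒-1≤ {q} p) (p≤p+ (ℚₚ.<⇒≤ 0<h))) (ℚₚ.<⇒≤ q+h<1)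

  -- The derivative of g A + κ B = e, without a product rule: only increments to the right of x are
  -- compared. The constant K is fixed before ε, so the estimate tends to 0.
  leibniz : fromℚ (affineℚ c q) *ᴿ (A′ ⟨$⟩ x) +ᴿ fromℚ (ι c) *ᴿ (A ⟨$⟩ x) +ᴿ fromℚ κ *ᴿ (B′ ⟨$⟩ x)
            ≈ᴿ fromℚ 0ℚ
  leibniz = mk≈ λ ε₀ 0<ε₀ → go ε₀ (bounded (A′ ⟨$⟩ x)) 0<ε₀
    where
    go : ∀ ε₀ → ∃[ K ] (0ℚ < K × Eventually λ n → ∣ seq (A′ ⟨$⟩ x) n ∣ ≤ K) → 0ℚ < ε₀ →
         Eventually λ n → dist (seq combination n) 0ℚ ≤ ε₀
    go ε₀ (K , 0<K , bA′) 0<ε₀ = rescale (shrink C 0<C ε₀ 0<ε₀)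
      where
      C = leibnizConstant W N κ K
      0<C : 0ℚ < C
      0<C = leibnizConstant-pos (+-nonneg (ℚₚ.0≤∣p∣ G) (ι-nonneg c)) (ι-nonneg c) 0≤κ (ℚₚ.<⇒≤ 0<K)
      rescale : ∃[ ε ] (0ℚ < ε × C * ε ≡ ε₀) → Eventually λ n → dist (seq combination n) 0ℚ ≤ ε₀
      rescale (ε , 0<ε , Cε≡ε₀) = let M , bound = at-scale bA′ ε 0<ε in M , λ n M≤n →
        subst₂ _≤_ (cong ∣_∣ (sym (ℚₚ.+-identityʳ (seq combination n)))) Cε≡ε₀ (bound n M≤n)

-- Derivatives of the reciprocal at -1

≈ᴿ-pointwise : ∀ {x y} → (∀ n → seq x n ≡ seq y n) → x ≈ᴿ y
≈ᴿ-pointwise {x} {y} x≡y = mk≈ λ ε 0<ε → 0 , λ n _ →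
  subst (_≤ ε) (trans (sym (dist-refl (seq x n))) (cong (dist (seq x n)) (x≡y n))) (ℚₚ.<⇒≤ 0<ε)

module _ {u : RealFunction} (D : InfinitelyDifferentiable u) (c : ℕ)
         (reciprocal : LinearRelation c 0ℚ 1ℚ (deriv D 0) (deriv D 0)) where

  -- g u⁽ᵏ⁺¹⁾ + (k + 1) g′ u⁽ᵏ⁾ = 0 for u = 1/g with g affine of slope c.
  recurrence : ∀ k → LinearRelation c (ι (suc k ℕ.* c)) 0ℚ (deriv D (suc k)) (deriv D k)
  recurrence zero q p q<1 = ≈ᴿ-trans
    (≈ᴿ-pointwise λ n → trans
      (cong (λ z → affineℚ c q * seq (u₁ ⟨$⟩ x) n + ι z * seq (u₀ ⟨$⟩ x) n) (ℕₚ.+-identityʳ c))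
      (solve 4 (λ g a m b → g :* a :+ m :* b := g :* a :+ m :* b :+ con 0ℚ :* a) refl
        (affineℚ c q) (seq (u₁ ⟨$⟩ x) n) (ι c) (seq (u₀ ⟨$⟩ x) n)))
    (leibniz c 0ℚ 1ℚ ℚₚ.≤-refl {u₀} {u₁} {u₀} {u₁} (deriv-suc D 0) (deriv-suc D 0)
      reciprocal q p q<1)
    where
    open ℚSolver
    x  = fromℚ q , p
    u₀ = deriv D 0
    u₁ = deriv D 1
  recurrence (suc k) q p q<1 = ≈ᴿ-trans
    (≈ᴿ-pointwise λ n → trans
      (cong (λ z → affineℚ c q * seq (u₂ ⟨$⟩ x) n + z * seq (u₁ ⟨$⟩ x) n) (ι-+ c (suc k ℕ.* c)))
      (solve 5 (λ g a m κ b → g :* a :+ (m :+ κ) :* b := g :* a :+ m :* b :+ κ :* b) refl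
        (affineℚ c q) (seq (u₂ ⟨$⟩ x) n) (ι c) (ι (suc k ℕ.* c)) (seq (u₁ ⟨$⟩ x) n)))
    (leibniz c (ι (suc k ℕ.* c)) 0ℚ (ι-nonneg (suc k ℕ.* c)) {u₁} {u₂} {u₀} {u₁}
      (deriv-suc D (suc k)) (deriv-suc D k) (recurrence k) q p q<1)
    where
    open ℚSolver
    x  = fromℚ q , p
    u₀ = deriv D k
    u₁ = deriv D (suc k)
    u₂ = deriv D (suc (suc k))

  private
    p₋₁ : fromℚ (- 1ℚ) ∈[-1,1]
    p₋₁ = fromℚ-∈ { - 1ℚ} ℚₚ.≤-refl (ℚₚ.≤-trans (ℚₚ.nonPositive⁻¹ (- 1ℚ)) (ℚₚ.nonNegative⁻¹ 1ℚ))

    -1<1 : - 1ℚ < 1ℚ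
    -1<1 = ℚₚ.neg<pos (- 1ℚ) 1ℚ

    at-₋₁ : ℕ → ℝ
    at-₋₁ k = deriv D k ⟨$⟩ (fromℚ (- 1ℚ) , p₋₁)

    affineℚ-₋₁ : affineℚ c (- 1ℚ) ≡ 1ℚ
    affineℚ-₋₁ = solve 1 (λ c → con 1ℚ :+ c :* (con 1ℚ :+ :- con 1ℚ) := con 1ℚ) refl (ι c)
      where open ℚSolver

    -- At -1 the recurrence reads a + κ b = 0, so a = - κ b. Here a and b are terms of Cauchy
    -- sequences and both equations hold only up to ε.
    next : ∀ {κ e a b ε} → 0ℚ ≤ κ → dist (affineℚ c (- 1ℚ) * a + κ * b) 0ℚ ≤ ε → dist b e ≤ ε →
           dist a (- κ * e) ≤ (1ℚ + κ) * ε
    next {κ} {e} {a} {b} {ε} 0≤κ ha hb = begin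
      ∣ a - - κ * e ∣
        ≡⟨ cong ∣_∣ (solve 4 (λ κ e a b → a :- :- κ :* e
                               := (con 1ℚ :* a :+ κ :* b :- con 0ℚ) :- κ :* (b :- e))
              refl κ e a b) ⟩
      ∣ (1ℚ * a + κ * b - 0ℚ) - κ * (b - e) ∣
        ≤⟨ ∣-∣≤ {1ℚ * a + κ * b - 0ℚ} {κ * (b - e)}
             (subst (λ z → dist (z * a + κ * b) 0ℚ ≤ ε) affineℚ-₋₁ ha)
             (∣*∣≤ {κ} {b - e} (ℚₚ.≤-reflexive (ℚₚ.0≤p⇒∣p∣≡p 0≤κ)) hb) ⟩
      ε + κ * ε           ≡⟨ solve 2 (λ κ ε → ε :+ κ :* ε := (con 1ℚ :+ κ) :* ε) refl κ ε ⟩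
      (1ℚ + κ) * ε        ∎
      where
      open ℚₚ.≤-Reasoning
      open ℚSolver

  -- The recursion makes e equal to ± k! cᵏ. Only cᵏ is kept in the lower bound, as the factor k!
  -- could not win against k ^ (γ k).
  derivative-₋₁ : ∀ k → ∃[ e ] (at-₋₁ k ≈ᴿ fromℚ e × ι (c ^ k) ≤ ∣ e ∣)
  derivative-₋₁ zero = 1ℚ , ≈ᴿ-trans
    (≈ᴿ-pointwise λ n → sym (trans
      (cong (λ z → z * seq (at-₋₁ 0) n + 0ℚ * seq (at-₋₁ 0) n) affineℚ-₋₁)
      (solve 1 (λ a → con 1ℚ :* a :+ con 0ℚ :* a := a) refl (seq (at-₋₁ 0) n))))
    (reciprocal (- 1ℚ) p₋₁ -1<1) , ℚₚ.≤-refl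
    where open ℚSolver
  derivative-₋₁ (suc k) with derivative-₋₁ k
  ... | e , ≈e , c^k≤ = - κ * e , mk≈ (λ ε 0<ε → near ε (shrink (1ℚ + κ) 0<1+κ ε 0<ε)) , large
    where
    κ = ι (suc k ℕ.* c)
    0≤κ = ι-nonneg (suc k ℕ.* c)
    0<1+κ : 0ℚ < 1ℚ + κ
    0<1+κ = ℚₚ.<-≤-trans (ℚₚ.positive⁻¹ 1ℚ) (p≤p+ 0≤κ)
    near : ∀ ε → ∃[ δ ] (0ℚ < δ × (1ℚ + κ) * δ ≡ ε) →
           Eventually λ n → dist (seq (at-₋₁ (suc k)) n) (- κ * e) ≤ ε
    near ε (δ , 0<δ , eq) = eventually₂
      (λ n ha hb → subst (dist (seq (at-₋₁ (suc k)) n) (- κ * e) ≤_) eq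
        (next {κ} {e} {seq (at-₋₁ (suc k)) n} {seq (at-₋₁ k) n} 0≤κ ha hb))
      (close (recurrence k (- 1ℚ) p₋₁ -1<1) δ 0<δ) (close ≈e δ 0<δ)
    large : ι (c ^ suc k) ≤ ∣ - κ * e ∣
    large = begin
      ι (c ^ suc k)         ≡⟨ ι-* c (c ^ k) ⟩
      ι c * ι (c ^ k)
        ≤⟨ *-mono-nonneg (ι-nonneg c) (ℚₚ.0≤∣p∣ e) (ι-mono-≤ (ℕₚ.m≤m+n c (k ℕ.* c))) c^k≤ ⟩
      κ * ∣ e ∣             ≡⟨ cong (_* ∣ e ∣) (sym (trans (ℚₚ.∣-p∣≡∣p∣ κ) (ℚₚ.0≤p⇒∣p∣≡p 0≤κ))) ⟩
      ∣ - κ ∣ * ∣ e ∣       ≡⟨ sym (ℚₚ.∣p*q∣≡∣p∣*∣q∣ (- κ) e) ⟩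
      ∣ - κ * e ∣           ∎
      where open ℚₚ.≤-Reasoning

  gevreyBound-large : ∀ {B ℓ γ} → GevreyBound D B ℓ γ → ∀ k → c ^ k ℕ.≤ B ℕ.* ℓ ^ k ℕ.* k ^ (γ ℕ.* k)
  gevreyBound-large {B} {ℓ} {γ} bound k with derivative-₋₁ k
  ... | e , ≈e , c^k≤ = ι-cancel-≤ {c ^ k} {b} (ℚₚ.≤-trans c^k≤ (≤-by-slack λ ε 0<ε →
    at (seq (at-₋₁ k)) ε (eventually₂ (λ _ → _,_)
      (close ≈e (½ * ε) (half-pos ε 0<ε))
      (below (bound k (fromℚ (- 1ℚ) , p₋₁)) (½ * ε) (half-pos ε 0<ε)))))
    where
    b = B ℕ.* ℓ ^ k ℕ.* k ^ (γ ℕ.* k)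
    at : ∀ s ε → (Eventually λ n → dist (s n) e ≤ ½ * ε × ∣ s n ∣ ≤ ι b + ½ * ε) → ∣ e ∣ ≤ ι b + ε
    at s ε (M , h) = begin
      ∣ e ∣                         ≤⟨ abs-≤ e (s M) ⟩
      ∣ s M ∣ + dist e (s M)        ≡⟨ cong (∣ s M ∣ +_) (dist-sym e (s M)) ⟩
      ∣ s M ∣ + dist (s M) e        ≤⟨ ℚₚ.+-mono-≤ (proj₂ (h M ℕₚ.≤-refl)) (proj₁ (h M ℕₚ.≤-refl)) ⟩
      (ι b + ½ * ε) + ½ * ε         ≡⟨ ℚₚ.+-assoc (ι b) (½ * ε) (½ * ε) ⟩
      ι b + (½ * ε + ½ * ε)         ≡⟨ cong (ι b +_) (halves ε) ⟩
      ι b + ε                       ∎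
      where open ℚₚ.≤-Reasoning

-- The quotient as a reciprocal

affine≥1 : ∀ {c K} (c≤ : 1 ℕ.+ c ℕ.* 3 ℕ.≤ 2 ^ K) → IsAtLeast1 (affineGevrey {c} {K} c≤)
affine≥1 {c} c≤ (x , -1≤x , _) = mk≤ λ ε 0<ε →
  slack ε (shrink (ι (suc c)) (ι-mono-< {0} {suc c} (s≤s z≤n)) ε 0<ε)
  where
  slack : ∀ ε → ∃[ δ ] (0ℚ < δ × ι (suc c) * δ ≡ ε) → Eventually λ n → 1ℚ ≤ affineℚ c (seq x n) + ε
  slack ε (δ , 0<δ , eq) = proj₁ (below -1≤x δ 0<δ) , λ n M≤n →
    let t = seq x n
        0≤1+t+δ : 0ℚ ≤ 1ℚ + t + δ
        0≤1+t+δ = subst (0ℚ ≤_) (sym (ℚₚ.+-assoc 1ℚ t δ))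
                    (ℚₚ.+-monoʳ-≤ 1ℚ (proj₂ (below -1≤x δ 0<δ) n M≤n))
    in begin
      1ℚ                                  ≤⟨ p≤p+ (*-nonneg (ι-nonneg c) 0≤1+t+δ) ⟩
      1ℚ + ι c * (1ℚ + t + δ)
        ≡⟨ solve 3 (λ c t d → con 1ℚ :+ c :* (con 1ℚ :+ t :+ d)
                     := (con 1ℚ :+ c :* (con 1ℚ :+ t)) :+ c :* d) refl (ι c) t δ ⟩
      affineℚ c t + ι c * δ
        ≤⟨ ℚₚ.+-monoʳ-≤ (affineℚ c t)
             (ℚₚ.*-monoʳ-≤-nonNeg δ {{ℚ.nonNegative (ℚₚ.<⇒≤ 0<δ)}} (ι-mono-≤ (ℕₚ.n≤1+n c))) ⟩
      affineℚ c t + ι (suc c) * δ         ≡⟨ cong (affineℚ c t +_) eq ⟩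
      affineℚ c t + ε                     ∎
    where
    open ℚₚ.≤-Reasoning
    open ℚSolver

-- This is g u = 1 with a term 0 · u added to fit the shape of `LinearRelation`. It starts the
-- recurrence. The junk value of `inv` is avoided because g ≥ 1.
quotient-reciprocal : ∀ {c K K′ h} (1≤ : 1 ℕ.≤ 2 ^ K′) (c≤ : 1 ℕ.+ c ℕ.* 3 ℕ.≤ 2 ^ K) g≥1 →
  IsQuotient (affineGevrey {0} {K′} 1≤) (affineGevrey {c} {K} c≤) h g≥1 →
  LinearRelation c 0ℚ 1ℚ (deriv (smooth h) 0) (deriv (smooth h) 0)
quotient-reciprocal {c} {K} {K′} {h} 1≤ c≤ g≥1 quotient q p q<1 =
  ≈ᴿ-trans (≈ᴿ-pointwise λ n →
      solve 2 (λ g a → g :* a :+ con 0ℚ :* a := g :* a) refl G (seq (deriv (smooth h) 0 ⟨$⟩ x) n))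
    (≈ᴿ-trans (*ᴿ-cong {fromℚ G} {fromℚ G} (≈ᴿ-refl {fromℚ G})
                (≈ᴿ-trans (deriv-zero (smooth h) x) (quotient x)))
      (≈ᴿ-pointwise λ n → begin
        G * (affineℚ 0 q * inv G)
          ≡⟨ solve 3 (λ g t i → g :* ((con 1ℚ :+ con 0ℚ :* (con 1ℚ :+ t)) :* i) := g :* i)
                refl G q (inv G) ⟩
        G * inv G                     ≡⟨ *-inv G G≢0 ⟩
        1ℚ                            ∎))
  where
  open ≡-Reasoning
  open ℚSolver
  x : Point𝕀
  x = fromℚ q , p
  G = affineℚ c q
  1≤G : 1ℚ ≤ G
  1≤G = p≤p+ (*-nonneg (ι-nonneg c) (ℚₚ.+-monoʳ-≤ 1ℚ (∈⇒-1≤ {q} p)))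
  G≢0 : G ≢ 0ℚ
  G≢0 G≡0 = ℚₚ.<-irrefl (sym G≡0) (ℚₚ.<-≤-trans (ℚₚ.positive⁻¹ 1ℚ) 1≤G)

-- The hard instances and what their outputs reveal

binaryFrom-bound : ∀ a w → binaryFrom a w ℕ.< 2 ^ length w ℕ.* suc a
binaryFrom-bound a []      = ℕₚ.≤-reflexive (sym (ℕₚ.+-identityʳ (suc a)))
binaryFrom-bound a (b ∷ w) = begin-strict
  binaryFrom (digit b ℕ.+ 2 ℕ.* a) w
    <⟨ binaryFrom-bound (digit b ℕ.+ 2 ℕ.* a) w ⟩
  2 ^ length w ℕ.* suc (digit b ℕ.+ 2 ℕ.* a)
    ≤⟨ ℕₚ.*-monoʳ-≤ (2 ^ length w) (s≤s (ℕₚ.+-monoˡ-≤ (2 ℕ.* a) (digit≤1 b))) ⟩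
  2 ^ length w ℕ.* (2 ℕ.+ 2 ℕ.* a)
    ≡⟨ solve 2 (λ p a → p :* (con 2 :+ con 2 :* a) := (con 2 :* p) :* (con 1 :+ a))
          refl (2 ^ length w) a ⟩
  2 ^ suc (length w) ℕ.* suc a                             ∎
  where
  open ℕₚ.≤-Reasoning
  open ℕSolver
  digit≤1 : ∀ b → digit b ℕ.≤ 1
  digit≤1 false = z≤n
  digit≤1 true  = ℕₚ.≤-refl

1+3·2^L≤2^2+L : ∀ L → 1 ℕ.+ 2 ^ L ℕ.* 3 ℕ.≤ 2 ^ (2 ℕ.+ L)
1+3·2^L≤2^2+L L = begin
  1 ℕ.+ 2 ^ L ℕ.* 3        ≤⟨ ℕₚ.+-monoˡ-≤ (2 ^ L ℕ.* 3) (ℕₚ.m^n>0 2 L) ⟩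
  2 ^ L ℕ.+ 2 ^ L ℕ.* 3
    ≡⟨ solve 1 (λ x → x :+ x :* con 3 := con 2 :* (con 2 :* x)) refl (2 ^ L) ⟩
  2 ^ (2 ℕ.+ L)            ∎
  where
  open ℕₚ.≤-Reasoning
  open ℕSolver

module _ (L : ℕ) where

  private
    K = 2 ℕ.+ L

  -- The constant 1 is also given the bound 2ᴷ, so that one size estimate covers both names.
  dividend divisor : GevreyFunction
  dividend = affineGevrey {0} {K} (ℕₚ.m^n>0 2 K)
  divisor  = affineGevrey {2 ^ L} {K} (1+3·2^L≤2^2+L L)

  divisor≥1 : IsAtLeast1 divisor
  divisor≥1 = affine≥1 {2 ^ L} {K} (1+3·2^L≤2^2+L L)

  inputs : Vec 𝓜 2
  inputs = gevreyName 0 K ∷ gevreyName (2 ^ L) K ∷ []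

  input : 𝓜
  input = tuple (Vec.lookup inputs)

  input-isName : RepresentedSpace._⊩_ (𝓖 ⊠ 𝓖) input (dividend , divisor)
  input-isName = gevreyName 0 K , gevreyName (2 ^ L) K ,
    gevreyName-isName 0 K (ℕₚ.m^n>0 2 K) , gevreyName-isName (2 ^ L) K (1+3·2^L≤2^2+L L) , λ _ → refl

  size-input : ∀ n → size input n ℕ.≤ n ℕ.+ (8 ℕ.+ 2 ℕ.* L)
  size-input n = begin
    size input n                                ≤⟨ size-tuple (Vec.lookup inputs) n ⟩
    suc (maxSize (Vec.lookup inputs) n)
      ≤⟨ s≤s (ℕₚ.⊔-lub (size-gevreyName 0 K n) (ℕₚ.⊔-lub (size-gevreyName (2 ^ L) K n) z≤n)) ⟩
    4 ℕ.+ (K ℕ.+ K) ℕ.+ n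
      ≡⟨ solve 2 (λ L n → con 4 :+ ((con 2 :+ L) :+ (con 2 :+ L)) :+ n
                   := n :+ (con 8 :+ con 2 :* L)) refl L n ⟩
    n ℕ.+ (8 ℕ.+ 2 ℕ.* L)                       ∎
    where
    open ℕₚ.≤-Reasoning
    open ℕSolver

-- With four components, `zeros 2` is an address followed by the empty word. Padding makes the
-- answer one longer than the longest component there, and constant functions show their full length
-- already on the empty word. So `ℓ`, 2 ^ `γ` and the number of digits of `B` are all at most 2ᴰ.
output-slope : ∀ L D {ψ h} g≥1 → IsQuotient (dividend L) (divisor L) h g≥1 →
  IsGevreyName ψ h → length (fun ψ (zeros 2)) ℕ.≤ 2 ^ D → L ℕ.≤ 1 ℕ.+ D ℕ.+ D ℕ.* D
output-slope L D {ψ} {h} g≥1 quotient name short =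
  slope-bound L D {B} {ℓ} {γ} B≤ ℓ≤ γ≤
    (gevreyBound-large (smooth h) (2 ^ L)
      (quotient-reciprocal {2 ^ L} {2 ℕ.+ L} {2 ℕ.+ L} {h}
        (ℕₚ.m^n>0 2 (2 ℕ.+ L)) (1+3·2^L≤2^2+L L) g≥1 quotient)
      {B} {ℓ} {γ} bound (2 ^ D))
  where
  open IsGevreyName name
  open ℕₚ.≤-Reasoning
  parts : Vec 𝓜 4
  parts = funName ∷ constant (true ∷ digits) ∷ constant (zeros ℓ) ∷ constant (zeros (2 ^ γ)) ∷ []
  part≤ : ∀ i → size (Vec.lookup parts i) 0 ℕ.≤ 2 ^ D
  part≤ i = begin
    size (Vec.lookup parts i) 0                ≤⟨ size≤maxSize (Vec.lookup parts) 0 i ⟩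
    maxSize (Vec.lookup parts) 0               ≤⟨ ℕₚ.n≤1+n _ ⟩
    suc (maxSize (Vec.lookup parts) 0)
      ≡⟨ sym (length-tupleFun (Vec.lookup parts) (zeros 2) (s≤s (s≤s z≤n))) ⟩
    length (tupleFun (Vec.lookup parts) (zeros 2))
      ≡⟨ cong length (sym (isTuple (zeros 2))) ⟩
    length (fun ψ (zeros 2))                   ≤⟨ short ⟩
    2 ^ D                                      ∎
  ℓ≤ : ℓ ℕ.≤ 2 ^ D
  ℓ≤ = subst (ℕ._≤ 2 ^ D) (length-replicate ℓ) (part≤ 2F)
  γ≤ : 2 ^ γ ℕ.≤ 2 ^ D
  γ≤ = subst (ℕ._≤ 2 ^ D) (length-replicate (2 ^ γ)) (part≤ 3F)
  B≤ : B ℕ.≤ 2 ^ (2 ^ D)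
  B≤ = begin
    B                                ≡⟨ sym B-binary ⟩
    binary (true ∷ digits)           ≤⟨ ℕₚ.<⇒≤ (binaryFrom-bound 0 (true ∷ digits)) ⟩
    2 ^ suc (length digits) ℕ.* 1    ≡⟨ ℕₚ.*-identityʳ (2 ^ suc (length digits)) ⟩
    2 ^ suc (length digits)          ≤⟨ ℕₚ.^-monoʳ-≤ 2 (part≤ 1F) ⟩
    2 ^ (2 ^ D)                      ∎

-- The exponent d depends on the time bound P alone, so L may be chosen after it. The argument word
-- has length 2 for every L.
polytime⇒slope-bound : PolytimeComputable (𝓖 ⊠ 𝓖) 𝓖 div →
  ∃[ d ] (∀ L D → (8 ℕ.+ 2 ℕ.* L) ^ d ℕ.≤ 2 ^ D → L ℕ.≤ 1 ℕ.+ D ℕ.+ D ℕ.* D)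
polytime⇒slope-bound (F , (M , P , correct) , realises) = degree P , λ L D time≤ →
  go L D time≤ (realises (input L) (dividend L , divisor L) (input-isName L) (divisor≥1 L))
  where
  go : ∀ L D → (8 ℕ.+ 2 ℕ.* L) ^ degree P ℕ.≤ 2 ^ D →
       Σ[ p ∈ PartialOperator.dom F (input L) ] Σ[ h ∈ GevreyFunction ]
         (IsGevreyName (PartialOperator.apply F (input L) p) h ×
          ∃[ g≥1 ] IsQuotient (dividend L) (divisor L) h g≥1) →
       L ℕ.≤ 1 ℕ.+ D ℕ.+ D ℕ.* D
  go L D time≤ (p , h , name , g≥1 , quotient) = output-slope L D {ψ} {h} g≥1 quotient name (begin
    length (fun ψ (zeros 2))             ≤⟨ output-length M (input L) (correct (input L) p (zeros 2)) ⟩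
    ⟦ P ⟧ (size (input L)) 2             ≤⟨ ⟦⟧-bound {size (input L)} 2≤M 2≤M (size-input L) P ⟩
    (8 ℕ.+ 2 ℕ.* L) ^ degree P           ≤⟨ time≤ ⟩
    2 ^ D                                ∎)
    where
    open ℕₚ.≤-Reasoning
    ψ = PartialOperator.apply F (input L) p
    2≤M : 2 ℕ.≤ 8 ℕ.+ 2 ℕ.* L
    2≤M = s≤s (s≤s z≤n)

-- Choice of the slope

time-bound : ∀ d i → (8 ℕ.+ 2 ℕ.* 2 ^ i) ^ d ℕ.≤ 2 ^ (d ℕ.* (i ℕ.+ 4))
time-bound d i = begin
  (8 ℕ.+ 2 ℕ.* 2 ^ i) ^ d       ≤⟨ ℕₚ.^-monoˡ-≤ d M≤ ⟩
  (2 ^ (i ℕ.+ 4)) ^ d           ≡⟨ ℕₚ.^-*-assoc 2 (i ℕ.+ 4) d ⟩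
  2 ^ ((i ℕ.+ 4) ℕ.* d)         ≡⟨ cong (2 ^_) (ℕₚ.*-comm (i ℕ.+ 4) d) ⟩
  2 ^ (d ℕ.* (i ℕ.+ 4))         ∎
  where
  open ℕₚ.≤-Reasoning
  M≤ : 8 ℕ.+ 2 ℕ.* 2 ^ i ℕ.≤ 2 ^ (i ℕ.+ 4)
  M≤ = begin
    8 ℕ.+ 2 ℕ.* 2 ^ i             ≤⟨ ℕₚ.+-monoˡ-≤ (2 ℕ.* 2 ^ i) (ℕₚ.*-monoʳ-≤ 8 (ℕₚ.m^n>0 2 i)) ⟩
    8 ℕ.* 2 ^ i ℕ.+ 2 ℕ.* 2 ^ i   ≡⟨ sym (ℕₚ.*-distribʳ-+ (2 ^ i) 8 2) ⟩
    10 ℕ.* 2 ^ i                  ≤⟨ ℕₚ.*-monoˡ-≤ (2 ^ i) (ℕₚ.m≤m+n 10 6) ⟩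
    16 ℕ.* 2 ^ i                  ≡⟨ ℕₚ.*-comm 16 (2 ^ i) ⟩
    2 ^ i ℕ.* 2 ^ 4               ≡⟨ sym (ℕₚ.^-distribˡ-+-* 2 i 4) ⟩
    2 ^ (i ℕ.+ 4)                 ∎

-- For L = 2ⁱ the exponent D = d (i + 4) is linear in i, so 1 + D + D² is quadratic in i while L is
-- exponential. The value i = 2 (4 + 2d) is large enough for every d.
slope-unbounded : ∀ d → ∃[ L ] ∃[ D ] ((8 ℕ.+ 2 ℕ.* L) ^ d ℕ.≤ 2 ^ D × 1 ℕ.+ D ℕ.+ D ℕ.* D ℕ.< L)
slope-unbounded d = at (4 ℕ.+ 2 ℕ.* d) refl
  where
  -- The variable m keeps 2 ^ (m + m) from being unfolded.
  at : ∀ m → m ≡ 4 ℕ.+ 2 ℕ.* d →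
       ∃[ L ] ∃[ D ] ((8 ℕ.+ 2 ℕ.* L) ^ d ℕ.≤ 2 ^ D × 1 ℕ.+ D ℕ.+ D ℕ.* D ℕ.< L)
  at m m≡ = 2 ^ (m ℕ.+ m) , d ℕ.* (m ℕ.+ m ℕ.+ 4) , time-bound d (m ℕ.+ m) , square-dominates d m m≡

theorem27 : ¬ PolytimeComputable (𝓖 ⊠ 𝓖) 𝓖 div
theorem27 computable = refute (polytime⇒slope-bound computable)
  where
  refute : ¬ (∃[ d ] (∀ L D → (8 ℕ.+ 2 ℕ.* L) ^ d ℕ.≤ 2 ^ D → L ℕ.≤ 1 ℕ.+ D ℕ.+ D ℕ.* D))
  refute (d , slope≤) = let L , D , time≤ , large = slope-unbounded d in ℕₚ.<⇒≱ large (slope≤ L D time≤)
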